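{- For every integer $n\ge3$, the graph $X_n$ is a connected vertex-transitive 3-RDR graph of order $12n$, and the following holds: (i) $g(X_3)=6$ and $\mathrm{sgn}(X_3)=(0,1,1)$. (ii) For $n\ge4$, $g(X_n)=8$ and $\mathrm{sgn}(X_n)=(5,5,6)$, with $X_n\cong\mathrm{GP}(6n,2n-1)$ if $n\equiv1\pmod3$, and $X_n\cong\mathrm{GP}(6n,2n+1)$ if $n\equiv-1\pmod3$; and $X_n$ is not isomorphic to any generalized Petersen graph if $n\equiv0\pmod3$.
   Context: Definition of $X_n$: let $D_n=\langle r,z\mid r^n=z^2=(zr)^2=1\rangle$ be the dihedral group of order $2n$, $n\ge3$, let $S_3$ be the symmetric group on $\{1,2,3\}$, and let $G=S_3\times D_n$. Put $a=((1\,2),1)$, $b=((1\,3),z)$, $c=((2\,3),zr)$ (three involutions of $G$) and $S=\{a,b,c\}$. Then $X_n=\mathrm{Cay}(G,S)$ is the graph with vertex set $G$ and edge set $\{\{g,gs\}: g\in G, s\in S\}$. All graphs are finite and simple. For a graph with vertex set $V$, $N(v)$ is the open neighbourhood of $v$. A $3$-rainbow dominating function (3-RDF) is a map $f\colon V\to 2^{\{1,2,3\}}$ such that $f(v)=\emptyset$ implies $\bigcup_{u\in N(v)}f(u)=\{1,2,3\}$, for all $v\in V$; $\gamma_{r3}$ is the minimum of $\sum_{v}|f(v)|$ over all 3-RDFs. A cubic (3-regular) graph is 3-RDR (3-rainbow domination regular) if $\gamma_{r3}=|V|/2$ (the known lower bound for cubic graphs). For $1\le k\le n/2$, the generalized Petersen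 graph $\mathrm{GP}(n,k)$ has vertex set $\{u_i,v_i: i\in\mathbb Z_n\}$ and edges $\{u_i,u_{i+1}\}$, $\{u_i,v_i\}$, $\{v_i,v_{i+k}\}$, $i\in\mathbb Z_n$. The girth $g(X)$ is the length of a shortest cycle of $X$; cycles of this length are girth cycles. For an edge $e$, $\epsilon(e)$ is the number of girth cycles containing $e$. The signature of a vertex $v$ of degree $3$ is the triple of values $\epsilon(e)$ of the three edges at $v$, in non-decreasing order. In a vertex-transitive graph all vertex signatures coincide, and the common value is the signature $\mathrm{sgn}(X)$. -}

module Defs where

open import Algebra.Bundles using (Group)
import Algebra.Construct.DirectProduct as DirectProduct
import Algebra.Properties.Group as GroupProperties
open import Data.Fin.Base using (Fin; toℕ)
open import Data.Fin.Patterns using (0F; 1F; 2F)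
open import Data.Fin.Permutation as Perm
  using (Permutation′; _⟨$⟩ʳ_; _⟨$⟩ˡ_; _∘ₚ_; transpose)
open import Data.Fin.Properties using (toℕ-fromℕ<)
open import Data.Fin.Subset using (Subset; _∈_; ∣_∣) renaming (⊥ to ∅)
open import Data.List.Base using (List; []; _∷_)
open import Data.List.Membership.Propositional using () renaming (_∈_ to _∈ₗ_)
open import Data.List.Relation.Unary.All as All using (All; []; _∷_)
open import Data.List.Relation.Unary.Any as Any using (Any)
open import Data.Nat.Base
  using (ℕ; zero; suc; _+_; _*_; _/_; _%_; _≤_; _<_; z≤n; s≤s)
open import Data.Nat.Divisibility using (divides; ∣⇒≤)
open import Data.Nat.DivMod using (_mod_; m%n<n; m≡m%n+[m/n]*n)
open import Data.Nat.Properties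
  using (+-0-commutativeMonoid; +-cancelˡ-≡; <⇒≱; <-≤-trans; m<m+n; ≤-trans; *-monoʳ-≤)
open import Data.Product.Base using (Σ-syntax; ∃; ∃₂; _×_; _,_; proj₁; proj₂)
open import Data.Sum.Base using (_⊎_)
open import Function.Bundles using (Inverse; _⇔_)
open import Function.Definitions using (Injective)
import Function.Properties.Equivalence as ⇔
open import Level using (0ℓ)
open import Relation.Binary.Bundles using (Setoid)
open import Relation.Binary.Construct.Closure.ReflexiveTransitive using (Star)
open import Relation.Binary.Construct.Closure.Symmetric as Sym using (SymClosure; fwd; bwd)
import Relation.Binary.Construct.On as On
open import Relation.Binary.Construct.Union using (_∪_)
open import Relation.Binary.Core using (Rel)
open import Relation.Binary.Definitions using (Symmetric; Irreflexive; _Respects₂_)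
open import Relation.Binary.PropositionalEquality
  using (_≡_; _≢_; refl; sym; trans; cong; module ≡-Reasoning)
import Relation.Binary.PropositionalEquality.Properties as ≡
open import Relation.Nullary.Negation using (¬_; contradiction)

open import Algebra.Properties.CommutativeMonoid.Sum +-0-commutativeMonoid using (sum)

HasCardinality : Setoid 0ℓ 0ℓ → ℕ → Set
HasCardinality S k = Inverse (≡.setoid (Fin k)) S

infixl 6 _⊕_

-- i + k in ℤₙ.
_⊕_ : ∀ {n} → Fin n → ℕ → Fin n
_⊕_ {suc n} i k = (toℕ i + k) mod suc n

i⊕k≢i : ∀ {n k} (i : Fin n) → 1 ≤ k → 2 * k ≤ n → i ≢ i ⊕ k
i⊕k≢i {suc n} {k@(suc _)} i _ 2k≤n i≡i⊕k =
  contradiction (∣⇒≤ (divides q k≡q*n)) (<⇒≱ k<n)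
  where
  q : ℕ
  q = (toℕ i + k) / suc n

  k≡q*n : k ≡ q * suc n
  k≡q*n = +-cancelˡ-≡ (toℕ i) k (q * suc n) (begin
    toℕ i + k                            ≡⟨ m≡m%n+[m/n]*n (toℕ i + k) (suc n) ⟩
    (toℕ i + k) % suc n + q * suc n      ≡⟨ cong (_+ q * suc n) (toℕ-fromℕ< (m%n<n (toℕ i + k) (suc n))) ⟨
    toℕ (i ⊕ k) + q * suc n              ≡⟨ cong (λ j → toℕ j + q * suc n) i≡i⊕k ⟨
    toℕ i + q * suc n                    ∎)
    where open ≡-Reasoning

  k<n : k < suc n
  k<n = <-≤-trans (m<m+n k (s≤s z≤n)) 2k≤n

-- A is the set of generators.
module Presentation {A : Set} where

  infixl 7 _∙_
  infix  8 _⁻¹ _^_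

  data Word : Set where
    gen : A → Word
    ε   : Word
    _∙_ : Word → Word → Word
    _⁻¹ : Word → Word

  _^_ : Word → ℕ → Word
  w ^ zero  = ε
  w ^ suc n = w ∙ w ^ n

  -- The congruence generated by the group axioms and w = 1 for each relator w.
  data Eq (R : List Word) : Rel Word 0ℓ where
    relator   : ∀ {w} → w ∈ₗ R → Eq R w ε
    reflexive : ∀ {w} → Eq R w w
    symmetric : ∀ {w x} → Eq R w x → Eq R x w
    transitive : ∀ {w x y} → Eq R w x → Eq R x y → Eq R w y
    ∙-cong    : ∀ {w x y z} → Eq R w x → Eq R y z → Eq R (w ∙ y) (x ∙ z)
    ⁻¹-cong   : ∀ {w x} → Eq R w x → Eq R (w ⁻¹) (x ⁻¹)
    assoc     : ∀ w x y → Eq R ((w ∙ x) ∙ y) (w ∙ (x ∙ y))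
    identityˡ : ∀ w → Eq R (ε ∙ w) w
    identityʳ : ∀ w → Eq R (w ∙ ε) w
    inverseˡ  : ∀ w → Eq R (w ⁻¹ ∙ w) ε
    inverseʳ  : ∀ w → Eq R (w ∙ w ⁻¹) ε

  presentedBy : List Word → Group 0ℓ 0ℓ
  presentedBy R = record
    { Carrier = Word
    ; _≈_     = Eq R
    ; _∙_     = _∙_
    ; ε       = ε
    ; _⁻¹     = _⁻¹
    ; isGroup = record
      { isMonoid = record
        { isSemigroup = record
          { isMagma = record
            { isEquivalence = record
              { refl = reflexive ; sym = symmetric ; trans = transitive }
            ; ∙-cong        = ∙-cong
            }
          ; assoc   = assoc
          }
        ; identity    = identityˡ , identityʳ
        }
      ; inverse  = inverseˡ , inverseʳ
      ; ⁻¹-cong  = ⁻¹-cong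
      }
    }

module Dihedral where
  open Presentation

  data Generator : Set where
    ρ ζ : Generator

  r z : Word
  r = gen ρ
  z = gen ζ

  D : ℕ → Group 0ℓ 0ℓ
  D n = presentedBy (r ^ n ∷ z ^ 2 ∷ (z ∙ r) ^ 2 ∷ [])

-- π ∘ₚ ρ applies π first.  The opposite convention yields an isomorphic
-- Cayley graph below: inversion is an isomorphism between the two groups and
-- fixes the transpositions.
symmetricGroup : ℕ → Group 0ℓ 0ℓ
symmetricGroup n = record
  { Carrier = Permutation′ n
  ; _≈_     = Perm._≈_
  ; _∙_     = _∘ₚ_
  ; ε       = Perm.id
  ; _⁻¹     = Perm.flip
  ; isGroup = record
    { isMonoid = record
      { isSemigroup = record
        { isMagma = record
          { isEquivalence = record
            { refl  = λ _ → refl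
            ; sym   = λ p i → sym (p i)
            ; trans = λ p q i → trans (p i) (q i)
            }
          ; ∙-cong = λ {π} {π′} {σ} {σ′} p q i →
              trans (cong (σ ⟨$⟩ʳ_) (p i)) (q (π′ ⟨$⟩ʳ i))
          }
        ; assoc = λ _ _ _ _ → refl
        }
      ; identity = (λ _ _ → refl) , (λ _ _ → refl)
      }
    ; inverse = (λ π _ → Perm.inverseʳ π) , (λ π _ → Perm.inverseˡ π)
    ; ⁻¹-cong = λ {π} {σ} p i →
        trans (sym (Perm.inverseˡ σ))
              (cong (σ ⟨$⟩ˡ_) (trans (sym (p (π ⟨$⟩ˡ i))) (Perm.inverseʳ π)))
    }
  }

-- The vertices form a setoid, because group elements do.
record Graph : Set₁ where
  infix 4 _~_
  field
    vertices : Setoid 0ℓ 0ℓ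
  open Setoid vertices public using (_≈_) renaming (Carrier to V)
  field
    _~_       : Rel V 0ℓ
    ~-resp-≈  : _~_ Respects₂ _≈_
    ~-sym     : Symmetric _~_
    ~-irrefl  : Irreflexive _≈_ _~_

Cay : (G : Group 0ℓ 0ℓ) (S : List (Group.Carrier G)) →
      All (λ s → ¬ Group._≈_ G s (Group.ε G)) S → Graph
Cay G S ε∉S = record
  { vertices = setoid
  ; _~_      = SymClosure Edge
  ; ~-resp-≈ = respʳ , λ p e → Sym.symmetric Edge (respʳ p (Sym.symmetric Edge e))
  ; ~-sym    = Sym.symmetric Edge
  ; ~-irrefl = λ { g≈h (fwd e) → irrefl g≈h e
                 ; g≈h (bwd e) → irrefl (Group.sym G g≈h) e }
  }
  where
  open Group G hiding (refl; sym; trans)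
  module G = Group G

  Edge : Rel Carrier 0ℓ
  Edge g h = Any (λ s → h ≈ g ∙ s) S

  respʳ : ∀ {g h h′} → h ≈ h′ → SymClosure Edge g h → SymClosure Edge g h′
  respʳ p (fwd e) = fwd (Any.map (G.trans (G.sym p)) e)
  respʳ p (bwd e) = bwd (Any.map (λ q → G.trans q (∙-congʳ p)) e)

  irrefl : ∀ {g h} → g ≈ h → ¬ Edge g h
  irrefl {g} {h} g≈h e = All.lookupAny ε∉S e .proj₁
    (GroupProperties.∙-cancelˡ G g _ _
      (G.trans (G.sym (All.lookupAny ε∉S e .proj₂))
        (G.trans (G.sym g≈h) (G.sym (identityʳ g)))))

data GPVertex (m : ℕ) : Set where
  u v : Fin m → GPVertex m

data GPEdge (m k : ℕ) : Rel (GPVertex m) 0ℓ where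
  outer : ∀ i → GPEdge m k (u i) (u (i ⊕ 1))
  spoke : ∀ i → GPEdge m k (u i) (v i)
  inner : ∀ i → GPEdge m k (v i) (v (i ⊕ k))

GP : (m k : ℕ) → 1 ≤ k → 2 * k ≤ m → Graph
GP m k 1≤k 2k≤m = record
  { vertices = ≡.setoid (GPVertex m)
  ; _~_      = SymClosure (GPEdge m k)
  ; ~-resp-≈ = (λ { refl e → e }) , (λ { refl e → e })
  ; ~-sym    = Sym.symmetric (GPEdge m k)
  ; ~-irrefl = λ { x≡y (fwd e) → irrefl x≡y e
                 ; x≡y (bwd e) → irrefl (sym x≡y) e }
  }
  where
  u-injective : ∀ {i j} → u {m} i ≡ u j → i ≡ j
  u-injective refl = refl

  v-injective : ∀ {i j} → v {m} i ≡ v j → i ≡ j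
  v-injective refl = refl

  irrefl : ∀ {x y} → x ≡ y → ¬ GPEdge m k x y
  irrefl eq (outer i) = i⊕k≢i i (s≤s z≤n) (≤-trans (*-monoʳ-≤ 2 1≤k) 2k≤m) (u-injective eq)
  irrefl () (spoke _)
  irrefl eq (inner i) = i⊕k≢i i 1≤k 2k≤m (v-injective eq)

infix 4 _≅_

record _≅_ (G H : Graph) : Set where
  private
    module G = Graph G
    module H = Graph H
  field
    bijection : Inverse G.vertices H.vertices
  open Inverse bijection public
  field
    ~-iff : ∀ x y → (x G.~ y) ⇔ (to x H.~ to y)

module _ (G : Graph) where
  open Graph G

  HasOrder : ℕ → Set
  HasOrder = HasCardinality vertices

  neighbourhood : V → Setoid 0ℓ 0ℓ
  neighbourhood x = On.setoid {B = ∃ (x ~_)} vertices proj₁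

  Cubic : Set
  Cubic = ∀ x → HasCardinality (neighbourhood x) 3

  -- Steps along _≈_ are allowed since a trivial walk only joins vertices that
  -- are propositionally equal.
  Connected : Set
  Connected = ∀ x y → Star (_≈_ ∪ _~_) x y

  VertexTransitive : Set
  VertexTransitive = ∀ x y → Σ[ φ ∈ G ≅ G ] _≅_.to φ x ≈ y

  record RDF : Set where
    field
      f          : V → Subset 3
      f-cong     : ∀ {x y} → x ≈ y → f x ≡ f y
      dominating : ∀ x → f x ≡ ∅ → ∀ c → ∃ λ y → x ~ y × c ∈ f y

  weight : ∀ {m} → HasOrder m → RDF → ℕ
  weight enum F = sum (λ i → ∣ RDF.f F (Inverse.to enum i) ∣)

  IsRainbowDominationNumber : ∀ {m} → HasOrder m → ℕ → Set
  IsRainbowDominationNumber enum γ =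
    (∃ λ F → weight enum F ≡ γ) × (∀ F → γ ≤ weight enum F)

  Is3RDR : Set
  Is3RDR = Cubic × ∃₂ λ m γ → Σ[ enum ∈ HasOrder m ]
    IsRainbowDominationNumber enum γ × 2 * γ ≡ m

  record Cycle (ℓ : ℕ) : Set where
    field
      3≤ℓ       : 3 ≤ ℓ
      vertex    : Fin ℓ → V
      injective : Injective _≡_ _≈_ vertex
      adjacent  : ∀ i → vertex i ~ vertex (i ⊕ 1)

    HasEdge : Rel V 0ℓ
    HasEdge x y = ∃ λ i → (vertex i ≈ x × vertex (i ⊕ 1) ≈ y) ⊎
                          (vertex i ≈ y × vertex (i ⊕ 1) ≈ x)

  -- Cycles are subgraphs: the starting point and the direction of traversal
  -- are disregarded.
  cycles : ℕ → Setoid 0ℓ 0ℓ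
  cycles ℓ = record
    { Carrier       = Cycle ℓ
    ; _≈_           = λ C C′ → ∀ x y → Cycle.HasEdge C x y ⇔ Cycle.HasEdge C′ x y
    ; isEquivalence = record
      { refl  = λ _ _ → ⇔.refl
      ; sym   = λ p x y → ⇔.sym (p x y)
      ; trans = λ p q x y → ⇔.trans (p x y) (q x y)
      }
    }

  cyclesThrough : ℕ → V → V → Setoid 0ℓ 0ℓ
  cyclesThrough ℓ x y = On.setoid {B = Σ[ C ∈ Cycle ℓ ] Cycle.HasEdge C x y} (cycles ℓ) proj₁

  HasGirth : ℕ → Set
  HasGirth g = Cycle g × (∀ {ℓ} → Cycle ℓ → g ≤ ℓ)

  -- ϵ({x,y}) = k; only used for adjacent x and y.
  GirthCycleCount : V → V → ℕ → Set
  GirthCycleCount x y k = ∃ λ g → HasGirth g × HasCardinality (cyclesThrough g x y) k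

  HasVertexSignature : V → ℕ × ℕ × ℕ → Set
  HasVertexSignature x (p , q , s) =
    p ≤ q × q ≤ s × Σ[ N ∈ HasCardinality (neighbourhood x) 3 ]
      let nbr = λ i → proj₁ (Inverse.to N i) in
      GirthCycleCount x (nbr 0F) p × GirthCycleCount x (nbr 1F) q × GirthCycleCount x (nbr 2F) s

  HasSignature : ℕ × ℕ × ℕ → Set
  HasSignature t = ∀ x → HasVertexSignature x t

-- The points 1, 2, 3 on which S₃ acts are 0F, 1F, 2F.
module _ (n : ℕ) where
  open Dihedral using (r; z; D)
  open Group (D n) using () renaming (_∙_ to _∙ᴰ_; ε to 1ᴰ)

  S₃×D : Group 0ℓ 0ℓ
  S₃×D = DirectProduct.group (symmetricGroup 3) (D n)

  open Group S₃×D using (Carrier; _≈_; ε)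

  a b c : Carrier
  a = transpose 0F 1F , 1ᴰ
  b = transpose 0F 2F , z
  c = transpose 1F 2F , z ∙ᴰ r

  X : Graph
  X = Cay S₃×D (a ∷ b ∷ c ∷ []) (a≉ε ∷ b≉ε ∷ c≉ε ∷ [])
    where
    a≉ε : ¬ a ≈ ε
    a≉ε (p , _) with () ← p 0F

    b≉ε : ¬ b ≈ ε
    b≉ε (p , _) with () ← p 0F

    c≉ε : ¬ c ≈ ε
    c≉ε (p , _) with () ← p 1F

{-# OPTIONS --safe #-}
module Submission where

-- Right multiplication by a, b, c colours the edges of X n, and left
-- multiplication is transitive.  A closed walk is a word in a, b, c with value 1.
-- A reduced word of length at most 8 that is trivial in S₃ and not a reflection
-- has r-exponent of absolute value less than 4, so for n ≥ 4 such a word is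
-- trivial in S₃ × Dₙ if and only if it is trivial in S₃ × D∞; the cycles through
-- an edge of a given colour are therefore counted by one finite enumeration.
-- The weight of a 3-RDF is bounded below by discharging, and the sets {π⁻¹(1)} on
-- even π attain the bound.  If 3 ∤ n, then bc has order 3n, the path 1, b, bc, …
-- is the outer rim of a generalized Petersen graph and the a-edges are its
-- spokes.  If 3 ∣ n, an isomorphism to GP(m,k) would turn the rotation of the rim
-- into an automorphism of X n; it preserves the a-edges, as these are the ones on
-- six 8-cycles, so the rim alternates between b and c and closes up after 2n < m
-- steps.

open import Defs
open import Data.Nat using (ℕ; zero; suc; _+_; _*_; _∸_; _≤_; _<_; _%_; _/_; z≤n; s≤s; >-nonZero)
open import Data.Product using (_×_; _,_; ∃; ∃₂; Σ-syntax; proj₁; proj₂)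
open import Relation.Binary.PropositionalEquality as ≡ using (_≡_; _≢_; refl; cong; cong₂; subst)
open import Relation.Nullary using (¬_; ¬?; does; yes; no; contradiction)

open import Algebra.Bundles using (Group)
import Algebra.Properties.Group as GroupProperties
open import Data.Bool.Base using (Bool; true; false; not; _xor_; if_then_else_)
import Data.Bool.Properties as Bool
open import Data.Fin.Base using (Fin; zero; suc; toℕ; fromℕ<; punchOut)
open import Data.Fin.Patterns using (0F; 1F; 2F)
open import Data.Fin.Permutation as Perm using (Permutation′; _⟨$⟩ʳ_; _⟨$⟩ˡ_; _∘ₚ_; transpose)
open import Data.Fin.Properties
  using (_≟_; all?; any?; toℕ<n; toℕ-injective; toℕ-fromℕ<; punchOut-injective; injective⇒≤; *↔×; +↔⊎; 2↔Bool)
open import Data.Fin.Subset as Subset using (Subset; _∈_; ∣_∣; ⁅_⁆; inside; outside) renaming (⊥ to ∅)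
open import Data.Fin.Subset.Properties
  using (nonempty?; Empty-unique; x∈⁅x⁆; ∣⁅x⁆∣≡1; p⊆q⇒∣p∣≤∣q∣; x∈p∪q⁺; x∈⁅y⁆⇒x≡y; ∉⊥)
open import Data.Integer.Base as ℤ using (ℤ)
open import Data.Integer.Divisibility.Signed as ℤ using (∣ᵤ⇒∣; ∣⇒∣ᵤ) renaming (_∣_ to _∣ℤ_)
import Data.Integer.Properties as ℤ
open import Data.List.Base using (List; []; _∷_; [_]; length; take; map; concatMap; filter; applyUpTo; lookup; allFin)
open import Data.List.Membership.Propositional using (lose; find) renaming (_∈_ to _∈ₗ_)
open import Data.List.Membership.Propositional.Properties
  using (∈-lookup; ∈-filter⁺; ∈-filter⁻; ∈-map⁺; ∈-map⁻; ∈-concatMap⁺; ∈-concatMap⁻; ∈-allFin)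
open import Data.List.Properties as List using (length-take; length-applyUpTo; take-all)
open import Data.List.Relation.Unary.All as All using (All)
open import Data.List.Relation.Unary.AllPairs using (_∷_; allPairs?)
open import Data.List.Relation.Unary.Any using (here; there; index)
open import Data.List.Relation.Unary.Any.Properties using (lookup-index)
open import Data.List.Relation.Unary.Linked as Linked using (Linked; []; [-]; _∷_)
open import Data.List.Relation.Unary.Linked.Properties using (applyUpTo⁺₂)
open import Data.List.Relation.Unary.Unique.Propositional using (Unique)
open import Data.Nat.DivMod
  using ( _mod_; _divMod_; result; m%n<n; m<n⇒m%n≡m; n%n≡0; m≡m%n+[m/n]*n; m%n%n≡m%n; [m+n]%n≡m%n
        ; [m+kn]%n≡m%n; %-distribˡ-+)
open import Data.Nat.Divisibility as ℕ∣ using (_∣_; _∣?_; ∣⇒≤; _∣0; 0∣⇒≡0; n∣m*n)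
open import Data.Nat.Primality using (prime?; euclidsLemma)
open import Data.Nat.Properties as ℕ
  using ( +-0-commutativeMonoid; +-comm; +-assoc; +-identityʳ; +-suc; +-mono-≤; +-cancelˡ-≡; *-suc; *-assoc; *-zeroʳ
        ; *-identityʳ; *-distribˡ-+; *-cancelˡ-≤; ≤-refl; ≤-trans; <⇒≤; <⇒≱; <-cmp; <-≤-trans; _<?_; 1+n≰n
        ; m≤m+n; m<m+n; m∸n+n≡m; m+[n∸m]≡n; m≤n⇒m<n∨m≡n; m≤n⇒m⊓n≡m)
open import Data.Nat.Tactic.RingSolver using (solve-∀)
open import Data.Product.Function.NonDependent.Propositional using (_×-↔_)
open import Data.Sum using (_⊎_; inj₁; inj₂; swap)
open import Data.Vec.Base using ([]; _∷_)
open import Function.Base using (_∘_)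
open import Function.Bundles using (_⇔_; _↔_; mk⇔; mk↔ₛ′; Equivalence; Injection; Inverse)
open import Function.Construct.Composition using (_↔-∘_) renaming (inverse to _∘-inverse_)
open import Function.Construct.Identity using (↔-id)
open import Function.Definitions using (Injective)
import Function.Properties.Equivalence as ⇔
open import Function.Properties.Inverse using (↔⇒↣)
open import Level using (0ℓ)
open import Relation.Binary.Bundles using (Setoid)
open import Relation.Binary.Construct.Closure.ReflexiveTransitive as Star using (Star; _◅_; _◅◅_)
open import Relation.Binary.Construct.Closure.Symmetric using (SymClosure; fwd; bwd)
open import Relation.Binary.Construct.Union using (_∪_)
open import Relation.Binary.Core using (Rel)
open import Relation.Binary.Definitions using (Symmetric; Irreflexive; _Respects₂_; tri<; tri≈; tri>)
import Relation.Binary.PropositionalEquality.Properties as ≡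
import Relation.Binary.Reasoning.Setoid as SetoidReasoning
open import Relation.Nullary.Decidable using (True; toWitness; from-yes; _→-dec_; _×-dec_)
open import Relation.Unary using (Decidable)

open import Algebra.Properties.CommutativeMonoid.Sum +-0-commutativeMonoid
  using (sum; sum-permute; ∑-distrib-+; sum-cong-≗)

-- `D n` is given by a presentation, so two words can be told apart only by invariants. The parity
-- of the letter z and the signed exponent of r are functions of the word alone; only the comparison
-- of exponents involves n. Values of words can therefore be computed once for all n. A cycle is a
-- subgraph without start or direction. Fixing an edge from x to xs supplies both: each cycle
-- through it has exactly one traversal that begins with this edge, hence one reduced word that
-- begins with s. Counting cycles becomes counting words. The case n = 3 stands apart because (bc)³
-- equals r³ in every `X n`. It closes up after six steps exactly when n divides 3, and it avoids
-- the letter a; this is the origin of the signature (0,1,1).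

-- Arithmetic in ℤₘ

toℕ-⊕ : ∀ {m} (i : Fin (suc m)) k → toℕ (i ⊕ k) ≡ (toℕ i + k) % suc m
toℕ-⊕ {m} i k = toℕ-fromℕ< (m%n<n (toℕ i + k) (suc m))

⊕-⊕ : ∀ {m} (i : Fin m) j k → (i ⊕ j) ⊕ k ≡ i ⊕ (j + k)
⊕-⊕ {m@(suc _)} i j k = toℕ-injective (begin
  toℕ ((i ⊕ j) ⊕ k)                    ≡⟨ toℕ-⊕ (i ⊕ j) k ⟩
  (toℕ (i ⊕ j) + k) % m                ≡⟨ cong (λ x → (x + k) % m) (toℕ-⊕ i j) ⟩
  ((toℕ i + j) % m + k) % m            ≡⟨ %-distribˡ-+ ((toℕ i + j) % m) k m ⟩
  ((toℕ i + j) % m % m + k % m) % m    ≡⟨ cong (λ x → (x + k % m) % m) (m%n%n≡m%n (toℕ i + j) m) ⟩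
  ((toℕ i + j) % m + k % m) % m        ≡⟨ %-distribˡ-+ (toℕ i + j) k m ⟨
  (toℕ i + j + k) % m                  ≡⟨ cong (_% m) (+-assoc (toℕ i) j k) ⟩
  (toℕ i + (j + k)) % m                ≡⟨ toℕ-⊕ i (j + k) ⟨
  toℕ (i ⊕ (j + k))                    ∎)
  where open ≡.≡-Reasoning

⊕-identityʳ : ∀ {m} (i : Fin m) → i ⊕ 0 ≡ i
⊕-identityʳ {m@(suc _)} i = toℕ-injective (begin
  toℕ (i ⊕ 0)        ≡⟨ toℕ-⊕ i 0 ⟩
  (toℕ i + 0) % m    ≡⟨ cong (_% m) (+-identityʳ (toℕ i)) ⟩
  toℕ i % m          ≡⟨ m<n⇒m%n≡m (toℕ<n i) ⟩
  toℕ i              ∎)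
  where open ≡.≡-Reasoning

⊕-period : ∀ {m} (i : Fin m) k → i ⊕ (k + m) ≡ i ⊕ k
⊕-period {m@(suc _)} i k = toℕ-injective (begin
  toℕ (i ⊕ (k + m))        ≡⟨ toℕ-⊕ i (k + m) ⟩
  (toℕ i + (k + m)) % m    ≡⟨ cong (_% m) (+-assoc (toℕ i) k m) ⟨
  (toℕ i + k + m) % m      ≡⟨ [m+n]%n≡m%n (toℕ i + k) m ⟩
  (toℕ i + k) % m          ≡⟨ toℕ-⊕ i k ⟨
  toℕ (i ⊕ k)              ∎)
  where open ≡.≡-Reasoning

⊕-full : ∀ {m} (i : Fin m) → i ⊕ m ≡ i
⊕-full i = ≡.trans (⊕-period i 0) (⊕-identityʳ i)

⊕-fixed⇒∣ : ∀ {m} (i : Fin m) k → i ⊕ k ≡ i → m ∣ k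
⊕-fixed⇒∣ {m@(suc _)} i k i⊕k≡i = ℕ∣.divides ((toℕ i + k) / m) (+-cancelˡ-≡ (toℕ i) _ _ (begin
  toℕ i + k                            ≡⟨ m≡m%n+[m/n]*n (toℕ i + k) m ⟩
  (toℕ i + k) % m + (toℕ i + k) / m * m  ≡⟨ cong (_+ (toℕ i + k) / m * m) (toℕ-⊕ i k) ⟨
  toℕ (i ⊕ k) + (toℕ i + k) / m * m    ≡⟨ cong (λ j → toℕ j + (toℕ i + k) / m * m) i⊕k≡i ⟩
  toℕ i + (toℕ i + k) / m * m          ∎))
  where open ≡.≡-Reasoning

⊕-cancelʳ : ∀ {m} k {i j : Fin m} → i ⊕ k ≡ j ⊕ k → i ≡ j
⊕-cancelʳ {suc m} k {i} {j} eq = ≡.trans (≡.sym (undo i)) (≡.trans (cong (_⊕ (k * m)) eq) (undo j))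
  where
  open ≡.≡-Reasoning

  periods : ∀ l (i : Fin (suc m)) → i ⊕ (l * suc m) ≡ i
  periods zero    i = ⊕-identityʳ i
  periods (suc l) i = ≡.trans (cong (i ⊕_) (+-comm (suc m) (l * suc m)))
                            (≡.trans (⊕-period i (l * suc m)) (periods l i))

  -- Modulo m + 1 the number k * m represents -k.
  undo : ∀ i → (i ⊕ k) ⊕ (k * m) ≡ i
  undo i = begin
    (i ⊕ k) ⊕ (k * m)   ≡⟨ ⊕-⊕ i k (k * m) ⟩
    i ⊕ (k + k * m)     ≡⟨ cong (i ⊕_) (*-suc k m) ⟨
    i ⊕ (k * suc m)     ≡⟨ periods k i ⟩
    i                   ∎

⊕-suc : ∀ {m} (i : Fin m) k → (i ⊕ k) ⊕ 1 ≡ i ⊕ suc k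
⊕-suc i k = ≡.trans (⊕-⊕ i k 1) (cong (i ⊕_) (+-comm k 1))

zero-⊕-toℕ : ∀ {m} (i : Fin (suc m)) → zero ⊕ toℕ i ≡ i
zero-⊕-toℕ i = toℕ-injective (≡.trans (toℕ-⊕ zero (toℕ i)) (m<n⇒m%n≡m (toℕ<n i)))

-- Congruent to the distance from i to j, but not reduced modulo m.
_⊝_ : ∀ {m} → Fin m → Fin m → ℕ
_⊝_ {m} j i = (m ∸ toℕ i) + toℕ j

⊕-⊝ : ∀ {m} (i j : Fin m) → i ⊕ (j ⊝ i) ≡ j
⊕-⊝ {m@(suc _)} i j = toℕ-injective (begin
  toℕ (i ⊕ (j ⊝ i))                    ≡⟨ toℕ-⊕ i (j ⊝ i) ⟩
  (toℕ i + (m ∸ toℕ i + toℕ j)) % m    ≡⟨ cong (_% m) (+-assoc (toℕ i) (m ∸ toℕ i) (toℕ j)) ⟨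
  (toℕ i + (m ∸ toℕ i) + toℕ j) % m    ≡⟨ cong (λ x → (x + toℕ j) % m) (m+[n∸m]≡n (<⇒≤ (toℕ<n i))) ⟩
  (m + toℕ j) % m                      ≡⟨ cong (_% m) (+-comm m (toℕ j)) ⟩
  (toℕ j + m) % m                      ≡⟨ [m+n]%n≡m%n (toℕ j) m ⟩
  toℕ j % m                            ≡⟨ m<n⇒m%n≡m (toℕ<n j) ⟩
  toℕ j                                ∎)
  where open ≡.≡-Reasoning

-- Negation, written as multiplication by m, which is -1 modulo m + 1; this avoids truncated
-- subtraction and a separate case at zero.
⊖ : ∀ {m} → Fin (suc m) → Fin (suc m)
⊖ {m} i = zero ⊕ (m * toℕ i)

⊖-suc : ∀ {m} (i : Fin (suc m)) → ⊖ (i ⊕ 1) ⊕ 1 ≡ ⊖ i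
⊖-suc {m} i = begin
  ⊖ (i ⊕ 1) ⊕ 1                        ≡⟨ ⊕-⊕ zero (m * toℕ (i ⊕ 1)) 1 ⟩
  zero ⊕ (m * toℕ (i ⊕ 1) + 1)         ≡⟨ cong (λ k → zero ⊕ (m * k + 1)) (toℕ-⊕ i 1) ⟩
  zero ⊕ (m * (j % suc m) + 1)         ≡⟨ toℕ-injective (begin
    toℕ (zero {m} ⊕ (m * (j % suc m) + 1))   ≡⟨ toℕ-⊕ zero (m * (j % suc m) + 1) ⟩
    (m * (j % suc m) + 1) % suc m            ≡⟨ [m+kn]%n≡m%n (m * (j % suc m) + 1) (m * (j / suc m)) (suc m) ⟨
    (m * (j % suc m) + 1 + m * (j / suc m) * suc m) % suc m
      ≡⟨ cong (_% suc m) arith ⟩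
    (m * toℕ i + suc m) % suc m              ≡⟨ toℕ-⊕ zero (m * toℕ i + suc m) ⟨
    toℕ (zero {m} ⊕ (m * toℕ i + suc m))     ∎) ⟩
  zero ⊕ (m * toℕ i + suc m)           ≡⟨ ⊕-period zero (m * toℕ i) ⟩
  ⊖ i                                  ∎
  where
  open ≡.≡-Reasoning
  j = toℕ i + 1
  arith : m * (j % suc m) + 1 + m * (j / suc m) * suc m ≡ m * toℕ i + suc m
  arith = begin
    m * (j % suc m) + 1 + m * (j / suc m) * suc m    ≡⟨ cong (m * (j % suc m) + 1 +_) (*-assoc m (j / suc m) (suc m)) ⟩
    m * (j % suc m) + 1 + m * (j / suc m * suc m)    ≡⟨ cong (_+ m * (j / suc m * suc m)) (+-comm (m * (j % suc m)) 1) ⟩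
    1 + (m * (j % suc m) + m * (j / suc m * suc m))  ≡⟨ cong suc (*-distribˡ-+ m (j % suc m) (j / suc m * suc m)) ⟨
    1 + m * (j % suc m + j / suc m * suc m)          ≡⟨ cong (λ x → 1 + m * x) (m≡m%n+[m/n]*n j (suc m)) ⟨
    1 + m * (toℕ i + 1)                              ≡⟨ cong suc (*-distribˡ-+ m (toℕ i) 1) ⟩
    1 + (m * toℕ i + m * 1)                          ≡⟨ cong (λ x → 1 + (m * toℕ i + x)) (*-identityʳ m) ⟩
    1 + (m * toℕ i + m)                              ≡⟨ +-suc (m * toℕ i) m ⟨
    m * toℕ i + suc m                                ∎

⊖-involutive : ∀ {m} (i : Fin (suc m)) → ⊖ (⊖ i) ≡ i
⊖-involutive {m} i = ≡.trans (cong (λ j → ⊖ (⊖ j)) (≡.sym (zero-⊕-toℕ i)))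
                           (≡.trans (steps (toℕ i)) (zero-⊕-toℕ i))
  where
  open ≡.≡-Reasoning
  base : ⊖ (zero {m}) ≡ zero
  base = ≡.trans (cong (zero ⊕_) (*-zeroʳ m)) (⊕-identityʳ zero)

  -- ⊖ (⊖ j) and j satisfy the same recursion.
  step : ∀ j → ⊖ (⊖ (j ⊕ 1)) ≡ ⊖ (⊖ j) ⊕ 1
  step j = ≡.sym (≡.trans (cong (λ x → ⊖ x ⊕ 1) (≡.sym (⊖-suc j))) (⊖-suc (⊖ (j ⊕ 1))))

  steps : ∀ k → ⊖ (⊖ (zero {m} ⊕ k)) ≡ zero ⊕ k
  steps zero    = ≡.trans (cong (λ j → ⊖ (⊖ j)) (⊕-identityʳ (zero {m})))
                    (≡.trans (cong ⊖ base) (≡.trans base (≡.sym (⊕-identityʳ zero))))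
  steps (suc k) = begin
    ⊖ (⊖ (zero ⊕ suc k))      ≡⟨ cong (λ j → ⊖ (⊖ j)) (⊕-suc zero k) ⟨
    ⊖ (⊖ ((zero ⊕ k) ⊕ 1))    ≡⟨ step (zero ⊕ k) ⟩
    ⊖ (⊖ (zero ⊕ k)) ⊕ 1      ≡⟨ cong (_⊕ 1) (steps k) ⟩
    (zero ⊕ k) ⊕ 1            ≡⟨ ⊕-suc zero k ⟩
    zero ⊕ suc k              ∎

-- Pigeonhole: if a value were missed, punching it out would squeeze `suc m` points injectively into
-- m.
injective⇒surjective : ∀ {m} (f : Fin m → Fin m) → Injective _≡_ _≡_ f → ∀ j → ∃ λ i → f i ≡ j
injective⇒surjective {suc m} f f-inj j with any? (λ i → f i ≟ j)
... | yes hit = hit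
... | no ¬hit = contradiction (injective⇒≤ {f = λ i → punchOut (avoids i)}
                                (λ {x} {y} eq → f-inj (punchOut-injective (avoids x) (avoids y) eq)))
                              (<⇒≱ ≤-refl)
  where
  avoids : ∀ i → j ≢ f i
  avoids i j≡fi = ¬hit (i , ≡.sym j≡fi)

-- Cycles in a graph

module Cycles (G : Graph) where
  open Graph G
  open Setoid vertices using (sym; trans; reflexive) renaming (refl to ≈-refl)
  open Cycle

  private variable ℓ : ℕ

  infix 4 _⊆_ _≋_

  _⊆_ : Cycle G ℓ → Cycle G ℓ → Set
  C ⊆ C′ = ∀ x y → HasEdge C x y → HasEdge C′ x y

  _≋_ : Cycle G ℓ → Cycle G ℓ → Set
  _≋_ {ℓ} = Setoid._≈_ (cycles G ℓ)

  ⊆-antisym : {C C′ : Cycle G ℓ} → C ⊆ C′ → C′ ⊆ C → C ≋ C′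
  ⊆-antisym p q x y = mk⇔ (p x y) (q x y)

  hasEdge-resp : (C : Cycle G ℓ) → ∀ {x x′ y y′} → x ≈ x′ → y ≈ y′ → HasEdge C x y → HasEdge C x′ y′
  hasEdge-resp C p q (i , inj₁ (r , s)) = i , inj₁ (trans r p , trans s q)
  hasEdge-resp C p q (i , inj₂ (r , s)) = i , inj₂ (trans r q , trans s p)

  hasEdge-sym : (C : Cycle G ℓ) → ∀ {x y} → HasEdge C x y → HasEdge C y x
  hasEdge-sym C (i , p) = i , swap p

  hasEdge-⊕1 : (C : Cycle G ℓ) → ∀ i → HasEdge C (vertex C i) (vertex C (i ⊕ 1))
  hasEdge-⊕1 C i = i , inj₁ (≈-refl , ≈-refl)

  ⊆-edges : {C C′ : Cycle G ℓ} → (∀ i → HasEdge C′ (vertex C i) (vertex C (i ⊕ 1))) → C ⊆ C′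
  ⊆-edges {C′ = C′} h x y (i , inj₁ (p , q)) = hasEdge-resp C′ p q (h i)
  ⊆-edges {C′ = C′} h x y (i , inj₂ (p , q)) = hasEdge-sym C′ (hasEdge-resp C′ p q (h i))

  pointwise⇒≋ : (C C′ : Cycle G ℓ) → (∀ i → vertex C i ≈ vertex C′ i) → C ≋ C′
  pointwise⇒≋ C C′ p = ⊆-antisym {C = C} {C′}
    (⊆-edges {C = C} {C′} λ i → hasEdge-resp C′ (sym (p i)) (sym (p (i ⊕ 1))) (hasEdge-⊕1 C′ i))
    (⊆-edges {C = C′} {C} λ i → hasEdge-resp C (p i) (p (i ⊕ 1)) (hasEdge-⊕1 C i))

  rotate : Cycle G ℓ → ℕ → Cycle G ℓ
  rotate C k = record
    { 3≤ℓ       = 3≤ℓ C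
    ; vertex    = λ i → vertex C (i ⊕ k)
    ; injective = λ p → ⊕-cancelʳ k (injective C p)
    ; adjacent  = λ i → ~-resp-≈ .proj₁ (reflexive (cong (vertex C) (exchange i))) (adjacent C (i ⊕ k))
    }
    where
    exchange : ∀ {ℓ} (i : Fin ℓ) → (i ⊕ k) ⊕ 1 ≡ (i ⊕ 1) ⊕ k
    exchange i = ≡.trans (⊕-suc i k) (≡.sym (⊕-⊕ i 1 k))

  rotate-≋ : (C : Cycle G (suc ℓ)) → ∀ k → C ≋ rotate C k
  rotate-≋ {ℓ} C k = ⊆-antisym {C = C} {rotate C k}
    (⊆-edges {C = C} {rotate C k} λ i → hasEdge-resp (rotate C k)
      (reflexive (cong (vertex C) (back i)))
      (reflexive (cong (vertex C) (≡.trans (⊕-⊕ (i′ i) 1 k) (≡.trans (≡.sym (⊕-suc (i′ i) k)) (cong (_⊕ 1) (back i))))))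
      (hasEdge-⊕1 (rotate C k) (i′ i)))
    (⊆-edges {C = rotate C k} {C} λ i → hasEdge-resp C ≈-refl
      (reflexive (cong (vertex C) (≡.trans (⊕-suc i k) (≡.sym (⊕-⊕ i 1 k)))))
      (hasEdge-⊕1 C (i ⊕ k)))
    where
    i′ : Fin (suc ℓ) → Fin (suc ℓ)
    i′ i = zero ⊕ (i ⊝ (zero ⊕ k))

    back : ∀ i → i′ i ⊕ k ≡ i
    back i = ≡.trans (⊕-⊕ zero d k) (≡.trans (cong (zero ⊕_) (+-comm d k))
               (≡.trans (≡.sym (⊕-⊕ zero k d)) (⊕-⊝ (zero ⊕ k) i)))
      where d = i ⊝ (zero ⊕ k)

  reverse : Cycle G (suc ℓ) → Cycle G (suc ℓ)
  reverse C = record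
    { 3≤ℓ       = 3≤ℓ C
    ; vertex    = λ i → vertex C (⊖ i)
    ; injective = λ {i} {j} p → ≡.trans (≡.sym (⊖-involutive i)) (≡.trans (cong ⊖ (injective C p)) (⊖-involutive j))
    ; adjacent  = λ i → ~-sym (~-resp-≈ .proj₁ (reflexive (cong (vertex C) (⊖-suc i))) (adjacent C (⊖ (i ⊕ 1))))
    }

  reverse-⊆ : (C : Cycle G (suc ℓ)) → reverse C ⊆ C
  reverse-⊆ C = ⊆-edges {C = reverse C} {C} λ i →
    hasEdge-sym C (hasEdge-resp C ≈-refl (reflexive (cong (vertex C) (⊖-suc i))) (hasEdge-⊕1 C (⊖ (i ⊕ 1))))

  -- One inclusion, applied to the reversed cycle, gives the other, because reversing twice restores
  -- every vertex.
  reverse-≋ : (C : Cycle G (suc ℓ)) → C ≋ reverse C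
  reverse-≋ C = ⊆-antisym {C = C} {reverse C}
    (λ x y e → reverse-⊆ (reverse C) x y
      (Equivalence.to (pointwise⇒≋ C (reverse (reverse C))
        (λ i → reflexive (cong (vertex C) (≡.sym (⊖-involutive i)))) x y) e))
    (reverse-⊆ C)

  -- Chooses, for a cycle through an edge, the traversal that runs along this edge first;
  -- `≋⇒pointwise` shows that there is only one.
  startAt : (C : Cycle G (suc ℓ)) → ∀ {x y} → HasEdge C x y →
    Σ[ C′ ∈ Cycle G (suc ℓ) ] C ≋ C′ × vertex C′ zero ≈ x × vertex C′ (zero ⊕ 1) ≈ y
  startAt {ℓ} C = go
    where
    fwd-case : (C : Cycle G (suc ℓ)) → ∀ {x y} i → vertex C i ≈ x → vertex C (i ⊕ 1) ≈ y →
      Σ[ C′ ∈ Cycle G (suc ℓ) ] C ≋ C′ × vertex C′ zero ≈ x × vertex C′ (zero ⊕ 1) ≈ y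
    fwd-case C i p q = rotate C (toℕ i) , rotate-≋ C (toℕ i) ,
      trans (reflexive (cong (vertex C) (zero-⊕-toℕ i))) p ,
      trans (reflexive (cong (vertex C)
        (≡.trans (⊕-⊕ zero 1 (toℕ i)) (≡.trans (≡.sym (⊕-suc zero (toℕ i))) (cong (_⊕ 1) (zero-⊕-toℕ i)))))) q

    go : ∀ {x y} → HasEdge C x y →
      Σ[ C′ ∈ Cycle G (suc ℓ) ] C ≋ C′ × vertex C′ zero ≈ x × vertex C′ (zero ⊕ 1) ≈ y
    go (i , inj₁ (p , q)) = fwd-case C i p q
    -- Position j of the reverse carries vertex -j of `C`, so an edge that `C` runs through from y
    -- to x is met forwards at position -(i + 1).
    go (i , inj₂ (p , q)) =
      let C′ , C″≋C′ , r = fwd-case (reverse C) (⊖ (i ⊕ 1))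
            (trans (reflexive (cong (vertex C) (⊖-involutive (i ⊕ 1)))) q)
            (trans (reflexive (cong (vertex C) (≡.trans (cong ⊖ (⊖-suc i)) (⊖-involutive i)))) p)
      in C′ , Setoid.trans (cycles G (suc ℓ)) {C} {reverse C} {C′} (reverse-≋ C) C″≋C′ , r

  -- At each vertex of a cycle only one edge leads on.
  ≋⇒pointwise : (C C′ : Cycle G (suc ℓ)) → C ≋ C′ →
    vertex C zero ≈ vertex C′ zero → vertex C (zero ⊕ 1) ≈ vertex C′ (zero ⊕ 1) →
    ∀ i → vertex C i ≈ vertex C′ i
  ≋⇒pointwise {ℓ} C C′ C≋C′ p₀ p₁ i =
    subst (λ j → vertex C j ≈ vertex C′ j) (zero-⊕-toℕ i) (go (toℕ i) .proj₁)
    where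
    P : ℕ → Set
    P k = vertex C (zero ⊕ k) ≈ vertex C′ (zero ⊕ k)

    onward : ∀ k → P k → P (suc k) → P (suc (suc k))
    onward k pₖ pₖ₊₁ with Equivalence.to (C≋C′ _ _) (hasEdge-⊕1 C (zero ⊕ suc k))
    ... | j , inj₁ (q , r) =
      trans (reflexive (cong (vertex C) (≡.sym (⊕-suc zero (suc k)))))
        (trans (sym r)
          (reflexive (cong (vertex C′) (≡.trans (cong (_⊕ 1) (injective C′ (trans q pₖ₊₁))) (⊕-suc zero (suc k))))))
    -- If `C′` ran through this edge backwards, positions k and k + 2 of `C` would agree and its
    -- length would divide 2.
    ... | j , inj₂ (q , r) = contradiction (∣⇒≤ (⊕-fixed⇒∣ (zero ⊕ k) 2 (≡.sym k≡k+2))) (<⇒≱ (3≤ℓ C))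
      where
      j≡k : j ≡ zero ⊕ k
      j≡k = ⊕-cancelʳ 1 (≡.trans (injective C′ (trans r pₖ₊₁)) (≡.sym (⊕-suc zero k)))

      k≡k+2 : zero ⊕ k ≡ (zero ⊕ k) ⊕ 2
      k≡k+2 = ≡.trans
        (injective C (trans pₖ (trans (reflexive (cong (vertex C′) (≡.sym j≡k))) q)))
        (≡.trans (cong (_⊕ 1) (≡.sym (⊕-suc zero k))) (⊕-⊕ (zero ⊕ k) 1 1))

    go : ∀ k → P k × P (suc k)
    go zero    = subst (λ j → vertex C j ≈ vertex C′ j) (≡.sym (⊕-identityʳ zero)) p₀ , p₁
    go (suc k) = let pₖ , pₖ₊₁ = go k in pₖ₊₁ , onward k pₖ pₖ₊₁

module CycleMap {G H : Graph} (φ : G ≅ H) where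
  private
    module G = Graph G
    module H = Graph H
    module φ = _≅_ φ
  open Cycle

  to-injective : ∀ {x y} → φ.to x H.≈ φ.to y → x G.≈ y
  to-injective p = trans (sym (φ.strictlyInverseʳ _)) (trans (φ.from-cong p) (φ.strictlyInverseʳ _))
    where open Setoid G.vertices

  mapCycle : ∀ {ℓ} → Cycle G ℓ → Cycle H ℓ
  mapCycle C = record
    { 3≤ℓ       = 3≤ℓ C
    ; vertex    = λ i → φ.to (vertex C i)
    ; injective = λ p → injective C (to-injective p)
    ; adjacent  = λ i → Equivalence.to (φ.~-iff _ _) (adjacent C i)
    }

  mapCycle-hasEdge : ∀ {ℓ} (C : Cycle G ℓ) {x y} → HasEdge C x y ⇔ HasEdge (mapCycle C) (φ.to x) (φ.to y)
  mapCycle-hasEdge C = mk⇔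
    (λ { (i , inj₁ (p , q)) → i , inj₁ (φ.to-cong p , φ.to-cong q)
       ; (i , inj₂ (p , q)) → i , inj₂ (φ.to-cong p , φ.to-cong q) })
    (λ { (i , inj₁ (p , q)) → i , inj₁ (to-injective p , to-injective q)
       ; (i , inj₂ (p , q)) → i , inj₂ (to-injective p , to-injective q) })

-- Cardinalities of setoids

module _ {B : Set} {S : Setoid 0ℓ 0ℓ} where

  open Setoid S

  bijective⇒inverse : (f : B → Carrier) → (∀ {i j} → f i ≈ f j → i ≡ j) → (∀ x → ∃ λ i → f i ≈ x) →
                      Inverse (≡.setoid B) S
  bijective⇒inverse f inj surj = record
    { to        = f
    ; from      = λ x → surj x .proj₁
    ; to-cong   = λ { ≡.refl → Setoid.refl S }
    ; from-cong = λ {x} {y} p → inj (trans (surj x .proj₂) (trans p (sym (surj y .proj₂))))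
    ; inverse   = (λ {x} p → trans (reflexive (cong f p)) (surj x .proj₂)) ,
                  (λ p → inj (trans (surj _ .proj₂) p))
    }

module _ {S T : Setoid 0ℓ 0ℓ} where

  private
    module S = Setoid S
    module T = Setoid T

  injection⇒≤ : ∀ {j k} → HasCardinality S j → HasCardinality T k →
    (f : S.Carrier → T.Carrier) → (∀ {x y} → f x T.≈ f y → x S.≈ y) → j ≤ k
  injection⇒≤ J K f inj = injective⇒≤ {f = λ i → from K (f (to J i))} λ {x} {y} p →
    ≡.trans (≡.sym (strictlyInverseʳ J x))
      (≡.trans (from-cong J (inj (T.trans (T.sym (strictlyInverseˡ K _))
                                (T.trans (to-cong K p) (strictlyInverseˡ K _)))))
               (strictlyInverseʳ J y))
    where open Inverse

lookup-injective : ∀ {A : Set} {xs : List A} → Unique xs → ∀ {i j} → lookup xs i ≡ lookup xs j → i ≡ j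
lookup-injective (x ∷ xs!) {zero}  {zero}  _ = refl
lookup-injective {xs = _ ∷ xs} (x ∷ xs!) {zero}  {suc j} p = contradiction p (All.lookup x (∈-lookup j))
lookup-injective {xs = _ ∷ xs} (x ∷ xs!) {suc i} {zero}  p = contradiction (≡.sym p) (All.lookup x (∈-lookup i))
lookup-injective (x ∷ xs!) {suc i} {suc j} p = cong suc (lookup-injective xs! p)

-- Reduced words and girth cycles in edge-coloured cubic graphs

-- The colours of a proper edge colouring; in X n the colours 0F, 1F, 2F are the
-- generators a, b, c.
Letter : Set
Letter = Fin 3

Word : Set
Word = List Letter

Reduced : Word → Set
Reduced = Linked _≢_

take-reduced : ∀ k {w} → Reduced w → Reduced (take k w)
take-reduced zero          _       = []
take-reduced (suc k)       []      = []
take-reduced (suc zero)    [-]     = [-]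
take-reduced (suc (suc k)) [-]     = [-]
take-reduced (suc zero)    (r ∷ _) = [-]
take-reduced (suc (suc k)) (r ∷ l) = r ∷ take-reduced (suc k) l

-- The number counts the letters after the first, so index k yields the words of length k + 1;
-- cycles of length `suc m` belong to index m.
reducedFrom : Letter → ℕ → List Word
reducedFrom s zero    = [ [ s ] ]
reducedFrom s (suc k) =
  map (s ∷_) (concatMap (λ t → reducedFrom t k) (filter (λ t → ¬? (s ≟ t)) (allFin 3)))

reducedFrom-complete : ∀ s w → Reduced (s ∷ w) → (s ∷ w) ∈ₗ reducedFrom s (length w)
reducedFrom-complete s []      _         = here refl
reducedFrom-complete s (t ∷ w) (s≢t ∷ l) =
  ∈-map⁺ (s ∷_) (∈-concatMap⁺ (λ t → reducedFrom t (length w))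
    (lose (∈-filter⁺ (λ t → ¬? (s ≟ t)) (∈-allFin t) s≢t) (reducedFrom-complete t w l)))

reducedFrom-sound : ∀ s k {w} → w ∈ₗ reducedFrom s k → ∃ λ w′ → w ≡ s ∷ w′ × Reduced w × length w′ ≡ k
reducedFrom-sound s zero    (here refl) = [] , refl , [-] , refl
reducedFrom-sound s (suc k) w∈ with ∈-map⁻ (s ∷_) w∈
... | w′ , w′∈ , refl with find (∈-concatMap⁻ (λ t → reducedFrom t k) {filter (λ t → ¬? (s ≟ t)) (allFin 3)} w′∈)
... | t , t∈ , w′∈′ with reducedFrom-sound t k w′∈′
... | w″ , refl , red , len =
  t ∷ w″ , refl , ∈-filter⁻ (λ t → ¬? (s ≟ t)) {xs = allFin 3} t∈ .proj₂ ∷ red , cong suc len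

module _ (G : Graph) where

  open Graph G

  -- Each colour acts as an involution along the edges of that colour. A walk is then a start and a
  -- word, and it never turns back at once exactly when the word is reduced.
  module Coloured
    (_·_ : V → Letter → V)
    (·-cong : ∀ {x y} s → x ≈ y → (x · s) ≈ (y · s))
    (~-· : ∀ x s → x ~ (x · s))
    (~⇒· : ∀ {x y} → x ~ y → ∃ λ s → y ≈ (x · s))
    (·-involutive : ∀ x s → ((x · s) · s) ≈ x)
    (·-injective : ∀ x {s t} → (x · s) ≈ (x · t) → s ≡ t)
    where

    open Setoid vertices using (sym; trans; reflexive) renaming (refl to ≈-refl)
    open Cycles G

    -- A vertex signature lists its edges by increasing count; `σ` provides the freedom to order the
    -- neighbours accordingly.
    neighbours : Permutation′ 3 → ∀ x → HasCardinality (neighbourhood G x) 3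
    neighbours σ x = bijective⇒inverse {S = neighbourhood G x}
      (λ i → x · (σ ⟨$⟩ʳ i) , ~-· x (σ ⟨$⟩ʳ i))
      (λ p → Injection.injective (↔⇒↣ σ) (·-injective x p))
      (λ { (y , x~y) → let s , y≈ = ~⇒· x~y in
           σ ⟨$⟩ˡ s , trans (reflexive (cong (x ·_) (Perm.inverseʳ σ))) (sym y≈) })

    walk : V → Word → V
    walk x []      = x
    walk x (s ∷ w) = walk (x · s) w

    walk-cong : ∀ {x y} w → x ≈ y → walk x w ≈ walk y w
    walk-cong []      p = p
    walk-cong (s ∷ w) p = walk-cong w (·-cong s p)

    -- Walks without immediate return, indexed by all of ℕ so that no end needs treatment. It serves
    -- twice: for unrolled cycles, and for the rim of a generalized Petersen graph pulled back to
    -- `X n`.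
    module Track (p : ℕ → V) (step : ∀ k → p k ~ p (suc k)) (onward : ∀ k → ¬ p (2 + k) ≈ p k) where

      letter : ℕ → Letter
      letter k = ~⇒· (step k) .proj₁

      p-suc : ∀ k → p (suc k) ≈ (p k · letter k)
      p-suc k = ~⇒· (step k) .proj₂

      letters : ℕ → Word
      letters = applyUpTo letter

      letter-changes : ∀ k → letter k ≢ letter (suc k)
      letter-changes k eq = onward k (trans (p-suc (suc k))
        (trans (·-cong (letter (suc k)) (p-suc k))
          (trans (reflexive (cong ((p k · letter k) ·_) (≡.sym eq))) (·-involutive (p k) (letter k)))))

      letters-reduced : ∀ k → Reduced (letters k)
      letters-reduced k = applyUpTo⁺₂ letter k letter-changes

    -- The walk is an explicit argument because the induction removes its first vertex.
    walk-letters : ∀ p step onward k l → l ≤ k → walk (p 0) (take l (Track.letters p step onward k)) ≈ p l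
    walk-letters p step onward k       zero    _         = ≈-refl
    walk-letters p step onward (suc k) (suc l) (s≤s l≤k) =
      trans (walk-cong (take l _) (sym (Track.p-suc p step onward 0)))
            (walk-letters (p ∘ suc) (step ∘ suc) (onward ∘ suc) k l l≤k)

    walk-all-letters : ∀ p step onward k → walk (p 0) (Track.letters p step onward k) ≈ p k
    walk-all-letters p step onward k =
      trans (reflexive (cong (walk (p 0)) (≡.sym (take-all k _ (ℕ.≤-reflexive (length-applyUpTo _ k))))))
            (walk-letters p step onward k k ≤-refl)

    walk-step : ∀ x w k → k < length w → walk x (take k w) ~ walk x (take (suc k) w)
    walk-step x (s ∷ w) zero    _         = ~-· x s
    walk-step x (s ∷ w) (suc k) (s≤s k<l) = walk-step (x · s) w k k<l

    walk-determines : ∀ x w w′ → length w ≡ length w′ →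
      (∀ k → k ≤ length w → walk x (take k w) ≈ walk x (take k w′)) → w ≡ w′
    walk-determines x []      []        _ _ = refl
    walk-determines x (s ∷ w) (s′ ∷ w′) l p with ·-injective x (p 1 (s≤s z≤n))
    ... | refl = cong (s ∷_) (walk-determines (x · s) w w′ (ℕ.suc-injective l) (λ k k≤ → p (suc k) (s≤s k≤)))

    -- The cycle is unrolled into a periodic walk. A length of at least 3 is what prevents an
    -- immediate return.
    module Walk {ℓ} (C : Cycle G (suc ℓ)) where
      open Cycle C

      p : ℕ → V
      p k = vertex (zero ⊕ k)

      step : ∀ k → p k ~ p (suc k)
      step k = ~-resp-≈ .proj₁ (reflexive (cong vertex (⊕-suc zero k))) (adjacent (zero ⊕ k))

      onward : ∀ k → ¬ p (2 + k) ≈ p k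
      onward k q = contradiction
        (∣⇒≤ (⊕-fixed⇒∣ (zero ⊕ k) 2
          (≡.trans (⊕-⊕ zero k 2) (≡.trans (cong (zero ⊕_) (+-comm k 2)) (injective q)))))
        (<⇒≱ 3≤ℓ)

      open Track p step onward public

      p-closed : p (suc ℓ) ≈ p 0
      p-closed = reflexive (cong vertex (⊕-period zero 0))

    -- Closedness has to agree with `Trivial` only on reduced words up to the length of a girth
    -- cycle. This restriction lets one predicate that does not mention n serve every n ≥ 4.
    module Circuits (m : ℕ) (3≤g : 3 ≤ suc m)
      (Trivial : Word → Set) (trivial? : Decidable Trivial)
      (closed⇔ : ∀ {w} → Reduced w → length w ≤ suc m → ∀ x → walk x w ≈ x ⇔ Trivial w)
      (noShort : ∀ s w → Reduced (s ∷ w) → length w < m → ¬ Trivial (s ∷ w))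
      where

      closedWords : Letter → List Word
      closedWords s = filter trivial? (reducedFrom s m)

      module _ (unique : ∀ s → Unique (closedWords s)) where

        -- The letters between two visits to the same vertex would form a nonempty trivial reduced
        -- word of at most m letters. Letters before the first visit are dropped by moving the
        -- start.
        simple : ∀ x w i j → i < j → j < suc m → j ≤ length w → Reduced w →
                 ¬ walk x (take i w) ≈ walk x (take j w)
        simple x (s ∷ w) zero (suc j) _ (s≤s j<m) (s≤s j≤l) red p =
          noShort s (take j w) (take-reduced (suc j) red) (subst (_< m) (≡.sym len) j<m)
            (Equivalence.to (closed⇔ (take-reduced (suc j) red) (s≤s (subst (_≤ m) (≡.sym len) (<⇒≤ j<m))) x) (sym p))
          where
          len : length (take j w) ≡ j
          len = ≡.trans (length-take j w) (m≤n⇒m⊓n≡m j≤l)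
        simple x (s ∷ w) (suc i) (suc j) (s≤s i<j) (s≤s j<m) (s≤s j≤l) red p =
          simple (x · s) w i j i<j (ℕ.m≤n⇒m≤1+n j<m) j≤l (Linked.tail red) p

        module _ (x : V) {s : Letter} {w : Word} (w∈ : w ∈ₗ closedWords s) where

          private
            w∈′ : w ∈ₗ reducedFrom s m
            w∈′ = ∈-filter⁻ trivial? {xs = reducedFrom s m} w∈ .proj₁

            red : Reduced w
            red = reducedFrom-sound s m w∈′ .proj₂ .proj₂ .proj₁

          length-closed : length w ≡ suc m
          length-closed with reducedFrom-sound s m w∈′
          ... | _ , refl , _ , len = cong suc len

          walk-first : walk x (take 1 w) ≡ x · s
          walk-first with reducedFrom-sound s m w∈′
          ... | _ , refl , _ , len = refl

          walk-closed : walk x (take (suc m) w) ≈ x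
          walk-closed = trans
            (reflexive (cong (walk x) (take-all (suc m) w (ℕ.≤-reflexive length-closed))))
            (Equivalence.from (closed⇔ red (ℕ.≤-reflexive length-closed) x)
              (∈-filter⁻ trivial? {xs = reducedFrom s m} w∈ .proj₂))

          private
            inj : ∀ {i j : Fin (suc m)} → walk x (take (toℕ i) w) ≈ walk x (take (toℕ j) w) → i ≡ j
            inj {i} {j} p with <-cmp (toℕ i) (toℕ j)
            ... | tri≈ _ eq _ = toℕ-injective eq
            ... | tri< lt _ _ = contradiction p
              (simple x w (toℕ i) (toℕ j) lt (toℕ<n j) (subst (toℕ j ≤_) (≡.sym length-closed) (<⇒≤ (toℕ<n j))) red)
            ... | tri> _ _ gt = contradiction (sym p)
              (simple x w (toℕ j) (toℕ i) gt (toℕ<n i) (subst (toℕ i ≤_) (≡.sym length-closed) (<⇒≤ (toℕ<n i))) red)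

            walk-wrap : ∀ k → k ≤ suc m → walk x (take k w) ≈ walk x (take (k % suc m) w)
            walk-wrap k k≤ with m≤n⇒m<n∨m≡n k≤
            ... | inj₁ k<   = reflexive (cong (λ k → walk x (take k w)) (≡.sym (m<n⇒m%n≡m k<)))
            ... | inj₂ refl = trans walk-closed (reflexive (cong (λ k → walk x (take k w)) (≡.sym (n%n≡0 (suc m)))))

            adj : ∀ (i : Fin (suc m)) → walk x (take (toℕ i) w) ~ walk x (take (toℕ (i ⊕ 1)) w)
            adj i = ~-resp-≈ .proj₁
              (trans (walk-wrap (suc (toℕ i)) (toℕ<n i))
                (reflexive (cong (λ k → walk x (take k w))
                  (≡.trans (cong (_% suc m) (+-comm 1 (toℕ i))) (≡.sym (toℕ-⊕ i 1))))))
              (walk-step x w (toℕ i) (subst (toℕ i <_) (≡.sym length-closed) (toℕ<n i)))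

          cycle : Cycle G (suc m)
          cycle = record
            { 3≤ℓ       = 3≤g
            ; vertex    = λ i → walk x (take (toℕ i) w)
            ; injective = inj
            ; adjacent  = adj
            }

          cycle-first : Cycle.vertex cycle (zero ⊕ 1) ≈ (x · s)
          cycle-first = trans
            (reflexive (cong (λ k → walk x (take k w)) (≡.trans (toℕ-⊕ {m} zero 1) (m<n⇒m%n≡m (≤-trans (s≤s (s≤s z≤n)) 3≤g)))))
            (reflexive walk-first)

          cycle-hasEdge : Cycle.HasEdge cycle x (x · s)
          cycle-hasEdge = zero , inj₁ (≈-refl , cycle-first)

        cycle-through : ∀ x s → Fin (length (closedWords s)) → Setoid.Carrier (cyclesThrough G (suc m) x (x · s))
        cycle-through x s i = cycle x (∈-lookup i) , cycle-hasEdge x (∈-lookup i)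

        -- Both traversals start at x and go to xs, so equal subgraphs are traversed equally, and
        -- the vertices of a walk determine its letters.
        cycle-through-injective : ∀ x s {i j} → cycle x {s} (∈-lookup i) ≋ cycle x (∈-lookup j) → i ≡ j
        cycle-through-injective x s {i} {j} C≋C′ = lookup-injective (unique s)
          (walk-determines x (w i) (w j) (≡.trans (len i) (≡.sym (len j))) same)
          where
          w : Fin (length (closedWords s)) → Word
          w i = lookup (closedWords s) i

          len : ∀ i → length (w i) ≡ suc m
          len i = length-closed x (∈-lookup i)

          pointwise : ∀ k → walk x (take (toℕ k) (w i)) ≈ walk x (take (toℕ k) (w j))
          pointwise = ≋⇒pointwise (cycle x (∈-lookup i)) (cycle x (∈-lookup j)) C≋C′ ≈-refl
            (trans (cycle-first x (∈-lookup i)) (sym (cycle-first x (∈-lookup j))))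

          same : ∀ k → k ≤ length (w i) → walk x (take k (w i)) ≈ walk x (take k (w j))
          same k k≤ with m≤n⇒m<n∨m≡n (subst (k ≤_) (len i) k≤)
          ... | inj₁ k<   = subst (λ k → walk x (take k (w i)) ≈ walk x (take k (w j)))
                              (toℕ-fromℕ< k<) (pointwise (fromℕ< k<))
          ... | inj₂ refl = trans (walk-closed x (∈-lookup i)) (sym (walk-closed x (∈-lookup j)))

        -- The word is read off from the traversal that starts with the given edge; it is reduced
        -- and closed, hence among those enumerated.
        cycle-through-surjective : ∀ x s (C : Setoid.Carrier (cyclesThrough G (suc m) x (x · s))) →
          ∃ λ i → cycle x {s} (∈-lookup i) ≋ C .proj₁
        cycle-through-surjective x s (C , e) with startAt C e
        ... | C′ , C≋C′ , v₀≈x , v₁≈xs =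
          index w∈ , Setoid.trans (cycles G (suc m)) {cycle x (∈-lookup (index w∈))} {C′} {C}
            (pointwise⇒≋ (cycle x (∈-lookup (index w∈))) C′ agree)
            (Setoid.sym (cycles G (suc m)) {C} {C′} C≋C′)
          where
          open Walk C′

          w : Word
          w = letters (suc m)

          p₀≈x : p 0 ≈ x
          p₀≈x = trans (reflexive (cong (Cycle.vertex C′) (⊕-identityʳ zero))) v₀≈x

          letter₀≡s : letter 0 ≡ s
          letter₀≡s = ·-injective x (trans (·-cong _ (sym p₀≈x)) (trans (sym (p-suc 0)) v₁≈xs))

          len : length w ≤ suc m
          len = ℕ.≤-reflexive (length-applyUpTo letter (suc m))

          w∈ : w ∈ₗ closedWords s
          w∈ = ∈-filter⁺ trivial?
            (≡.subst₂ (λ t k → w ∈ₗ reducedFrom t k) letter₀≡s (length-applyUpTo (letter ∘ suc) m)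
              (reducedFrom-complete (letter 0) (applyUpTo (letter ∘ suc) m) (letters-reduced (suc m))))
            (Equivalence.to (closed⇔ (letters-reduced (suc m)) len (p 0))
              (trans (walk-all-letters p step onward (suc m)) p-closed))

          agree : ∀ i → walk x (take (toℕ i) (lookup (closedWords s) (index w∈))) ≈ Cycle.vertex C′ i
          agree i = trans (reflexive (cong (λ w → walk x (take (toℕ i) w)) (≡.sym (lookup-index w∈))))
            (trans (walk-cong (take (toℕ i) w) (sym p₀≈x))
              (trans (walk-letters p step onward (suc m) (toℕ i) (<⇒≤ (toℕ<n i)))
                (reflexive (cong (Cycle.vertex C′) (zero-⊕-toℕ i)))))

        cyclesThrough-cardinality : ∀ x s →
          HasCardinality (cyclesThrough G (suc m) x (x · s)) (length (closedWords s))
        cyclesThrough-cardinality x s = bijective⇒inverse {S = cyclesThrough G (suc m) x (x · s)}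
          (cycle-through x s)
          (cycle-through-injective x s)
          (cycle-through-surjective x s)

        girth : V → ∀ {s w} → w ∈ₗ closedWords s → HasGirth G (suc m)
        girth x w∈ = cycle x w∈ , λ {ℓ} C → noShorter ℓ C
          where
          noShorter : ∀ ℓ → Cycle G ℓ → suc m ≤ ℓ
          noShorter zero    C = contradiction (Cycle.3≤ℓ C) λ ()
          noShorter (suc ℓ) C with ℕ.<-≤-connex ℓ m
          ... | inj₂ m≤ℓ = s≤s m≤ℓ
          ... | inj₁ ℓ<m = contradiction
            (Equivalence.to (closed⇔ (letters-reduced (suc ℓ))
                (≤-trans (ℕ.≤-reflexive (length-applyUpTo letter (suc ℓ))) (s≤s (<⇒≤ ℓ<m))) (p 0))
              (trans (walk-all-letters p step onward (suc ℓ)) p-closed))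
            (noShort (letter 0) (applyUpTo (letter ∘ suc) ℓ) (letters-reduced (suc ℓ))
              (subst (_< m) (≡.sym (length-applyUpTo (letter ∘ suc) ℓ)) ℓ<m))
            where open Walk C

-- Generalized Petersen graphs

≅-sym : ∀ {G H} → G ≅ H → H ≅ G
≅-sym {G} {H} φ = record
  { bijection = record
    { to        = from
    ; from      = to
    ; to-cong   = from-cong
    ; from-cong = to-cong
    ; inverse   = inverseʳ , inverseˡ
    }
  ; ~-iff = λ x y → mk⇔
      (λ p → Equivalence.from (~-iff (from x) (from y))
        (~-resp-≈ .proj₁ (sym (strictlyInverseˡ y)) (~-resp-≈ .proj₂ (sym (strictlyInverseˡ x)) p)))
      (λ p → ~-resp-≈ .proj₁ (strictlyInverseˡ y) (~-resp-≈ .proj₂ (strictlyInverseˡ x)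
        (Equivalence.to (~-iff (from x) (from y)) p)))
  }
  where
  open _≅_ φ
  open Graph H using (~-resp-≈)
  open Eq₂ using (sym)

u-injective : ∀ {m} {i j : Fin m} → u i ≡ u j → i ≡ j
u-injective refl = refl

v-injective : ∀ {m} {i j : Fin m} → v i ≡ v j → i ≡ j
v-injective refl = refl

GPVertex↔Fin : ∀ m → Fin (m + m) ↔ GPVertex m
GPVertex↔Fin m = mk↔ₛ′
  (λ { (inj₁ i) → u i ; (inj₂ i) → v i }) (λ { (u i) → inj₁ i ; (v i) → inj₂ i })
  (λ { (u i) → refl ; (v i) → refl }) (λ { (inj₁ i) → refl ; (inj₂ i) → refl })
  ↔-∘ +↔⊎

⊕-∸ : ∀ {m} (i : Fin m) {k} → k ≤ m → (i ⊕ (m ∸ k)) ⊕ k ≡ i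
⊕-∸ {m} i {k} k≤m = ≡.trans (⊕-⊕ i (m ∸ k) k) (≡.trans (cong (i ⊕_) (m∸n+n≡m k≤m)) (⊕-full i))

⊕≢⊕-∸ : ∀ {m} (i : Fin m) {k} → 1 ≤ k → 2 * k < m → i ⊕ k ≢ i ⊕ (m ∸ k)
⊕≢⊕-∸ {m} i {k} 1≤k 2k<m p = contradiction
  (∣⇒≤ {{>-nonZero (≤-trans 1≤k (m≤m+n k (k + 0)))}} (⊕-fixed⇒∣ i (2 * k)
    (≡.trans (cong (λ l → i ⊕ (k + l)) (+-identityʳ k)) (≡.trans (≡.sym (⊕-⊕ i k k))
      (≡.trans (cong (_⊕ k) p) (⊕-∸ i (≤-trans (m≤m+n k (k + 0)) (ℕ.<⇒≤ 2k<m))))))))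
  (<⇒≱ 2k<m)

-- The inequality is strict because for 2k = m the inner neighbours i + k and i - k coincide and the
-- graph is not cubic.
module GPNeighbours {m k} (1≤k : 1 ≤ k) (2k<m : 2 * k < m) where

  k≤m : k ≤ m
  k≤m = ≤-trans (m≤m+n k (k + 0)) (ℕ.<⇒≤ 2k<m)

  neighbour : GPVertex m → Fin 3 → GPVertex m
  neighbour (u i) 0F = u (i ⊕ 1)
  neighbour (u i) 1F = u (i ⊕ (m ∸ 1))
  neighbour (u i) 2F = v i
  neighbour (v i) 0F = v (i ⊕ k)
  neighbour (v i) 1F = v (i ⊕ (m ∸ k))
  neighbour (v i) 2F = u i

  neighbour-edge : ∀ x j → SymClosure (GPEdge m k) x (neighbour x j)
  neighbour-edge (u i) 0F = fwd (outer i)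
  neighbour-edge (u i) 1F = bwd (subst (λ j → GPEdge m k (u (i ⊕ (m ∸ 1))) (u j))
    (⊕-∸ i (≤-trans 1≤k k≤m)) (outer (i ⊕ (m ∸ 1))))
  neighbour-edge (u i) 2F = fwd (spoke i)
  neighbour-edge (v i) 0F = fwd (inner i)
  neighbour-edge (v i) 1F = bwd (subst (λ j → GPEdge m k (v (i ⊕ (m ∸ k))) (v j))
    (⊕-∸ i k≤m) (inner (i ⊕ (m ∸ k))))
  neighbour-edge (v i) 2F = bwd (spoke i)

  private
    outer≢ : ∀ (i : Fin m) → u (i ⊕ 1) ≢ u (i ⊕ (m ∸ 1))
    outer≢ i p = ⊕≢⊕-∸ i (s≤s z≤n) (ℕ.≤-<-trans (ℕ.*-monoʳ-≤ 2 1≤k) 2k<m) (u-injective p)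

    inner≢ : ∀ (i : Fin m) → v (i ⊕ k) ≢ v (i ⊕ (m ∸ k))
    inner≢ i p = ⊕≢⊕-∸ i 1≤k 2k<m (v-injective p)

  neighbour-injective : ∀ x {j l} → neighbour x j ≡ neighbour x l → j ≡ l
  neighbour-injective (u i) {0F} {0F} p = refl
  neighbour-injective (u i) {0F} {1F} p = contradiction p (outer≢ i)
  neighbour-injective (u i) {1F} {0F} p = contradiction (≡.sym p) (outer≢ i)
  neighbour-injective (u i) {1F} {1F} p = refl
  neighbour-injective (u i) {0F} {2F} ()
  neighbour-injective (u i) {1F} {2F} ()
  neighbour-injective (u i) {2F} {2F} p = refl
  neighbour-injective (v i) {0F} {0F} p = refl
  neighbour-injective (v i) {0F} {1F} p = contradiction p (inner≢ i)
  neighbour-injective (v i) {1F} {0F} p = contradiction (≡.sym p) (inner≢ i)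
  neighbour-injective (v i) {1F} {1F} p = refl
  neighbour-injective (v i) {0F} {2F} ()
  neighbour-injective (v i) {1F} {2F} ()
  neighbour-injective (v i) {2F} {2F} p = refl

-- The dihedral group

module DihedralGroup where

  open import Data.Integer.Base using (+_; -[1+_]; -_)
  open import Data.Integer.Divisibility.Signed using (divides)
  open import Data.Integer.Tactic.RingSolver using () renaming (solve-∀ to solve-∀ℤ)
  open Dihedral
  open Presentation {Generator} hiding (Word)

  Dih : Set
  Dih = Presentation.Word {Generator}

  signed : Bool → ℤ → ℤ
  signed false e = e
  signed true  e = - e

  -- w equals r ^ exponent w ∙ z if it is a reflection, and r ^ exponent w otherwise.
  reflection : Dih → Bool
  reflection (gen ρ) = false
  reflection (gen ζ) = true
  reflection ε       = false
  reflection (w ∙ x) = reflection w xor reflection x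
  reflection (w ⁻¹)  = reflection w

  exponent : Dih → ℤ
  exponent (gen ρ) = + 1
  exponent (gen ζ) = + 0
  exponent ε       = + 0
  exponent (w ∙ x) = exponent w ℤ.+ signed (reflection w) (exponent x)
  exponent (w ⁻¹)  = - signed (reflection w) (exponent w)

  infix 4 _≡_[mod_]

  _≡_[mod_] : ℤ → ℤ → ℕ → Set
  e ≡ f [mod n ] = + n ∣ℤ e ℤ.- f

  module _ {n : ℕ} where

    mod-reflexive : ∀ {e f} → e ≡ f → e ≡ f [mod n ]
    mod-reflexive {e} refl = divides (+ 0) (ℤ.+-inverseʳ e)

    mod-sym : ∀ {e f} → e ≡ f [mod n ] → f ≡ e [mod n ]
    mod-sym {e} {f} (divides q p) = divides (- q)
      (≡.trans (lemma e f) (≡.trans (cong -_ p) (ℤ.neg-distribˡ-* q (+ n))))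
      where
      lemma : ∀ e f → f ℤ.- e ≡ - (e ℤ.- f)
      lemma = solve-∀ℤ

    mod-trans : ∀ {e f g} → e ≡ f [mod n ] → f ≡ g [mod n ] → e ≡ g [mod n ]
    mod-trans {e} {f} {g} p q = subst (+ n ∣ℤ_) (lemma e f g) (ℤ.∣m∣n⇒∣m+n p q)
      where
      lemma : ∀ e f g → (e ℤ.- f) ℤ.+ (f ℤ.- g) ≡ e ℤ.- g
      lemma = solve-∀ℤ

    mod-neg : ∀ {e f} → e ≡ f [mod n ] → - e ≡ - f [mod n ]
    mod-neg {e} {f} p = subst (+ n ∣ℤ_) (lemma e f) (ℤ.∣m⇒∣-m p)
      where
      lemma : ∀ e f → - (e ℤ.- f) ≡ - e ℤ.- - f
      lemma = solve-∀ℤ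

    mod-+ : ∀ {e f g h} → e ≡ f [mod n ] → g ≡ h [mod n ] → e ℤ.+ g ≡ f ℤ.+ h [mod n ]
    mod-+ {e} {f} {g} {h} p q = subst (+ n ∣ℤ_) (lemma e f g h) (ℤ.∣m∣n⇒∣m+n p q)
      where
      lemma : ∀ e f g h → (e ℤ.- f) ℤ.+ (g ℤ.- h) ≡ (e ℤ.+ g) ℤ.- (f ℤ.+ h)
      lemma = solve-∀ℤ

    mod-signed : ∀ s {e f} → e ≡ f [mod n ] → signed s e ≡ signed s f [mod n ]
    mod-signed false p = p
    mod-signed true {e} {f} p = mod-neg {e} {f} p

  mod⇒%≡% : ∀ k l {n} → + k ≡ + l [mod suc n ] → k % suc n ≡ l % suc n
  mod⇒%≡% k l {n} (divides (+ q) p) = ≡.trans (cong (_% suc n) k≡) ([m+kn]%n≡m%n l q (suc n))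
    where
    lemma : ∀ k l → k ≡ l ℤ.+ (k ℤ.- l)
    lemma = solve-∀ℤ
    k≡ : k ≡ l + q * suc n
    k≡ = ℤ.+-injective (≡.trans (lemma (+ k) (+ l)) (≡.trans (cong (λ i → + l ℤ.+ i) p)
           (≡.trans (cong (λ i → + l ℤ.+ i) (≡.sym (ℤ.pos-* q (suc n)))) (≡.sym (ℤ.pos-+ l (q * suc n))))))
  -- Exchanging k and l makes a negative quotient positive.
  mod⇒%≡% k l {n} k≡l@(divides -[1+ q ] p) = ≡.sym (mod⇒%≡% l k (mod-sym {e = + k} {+ l} k≡l))

  exponent-r^ : ∀ k → exponent (r ^ k) ≡ + k
  exponent-r^ zero    = refl
  exponent-r^ (suc k) = cong₂ ℤ._+_ {+ 1} refl (exponent-r^ k)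

  reflection-r^ : ∀ k → reflection (r ^ k) ≡ false
  reflection-r^ zero    = refl
  reflection-r^ (suc k) = reflection-r^ k

  z^_ : Bool → Dih
  z^ false = ε
  z^ true  = z

  reflection-rz : ∀ k s → reflection (r ^ k ∙ z^ s) ≡ s
  reflection-rz k false rewrite reflection-r^ k = refl
  reflection-rz k true  rewrite reflection-r^ k = refl

  exponent-rz : ∀ k s → exponent (r ^ k ∙ z^ s) ≡ + k
  exponent-rz k false rewrite reflection-r^ k | exponent-r^ k = cong +_ (+-identityʳ k)
  exponent-rz k true  rewrite reflection-r^ k | exponent-r^ k = cong +_ (+-identityʳ k)

  module _ {n : ℕ} where
    open Group (D n) using (_≈_)

    -- Soundness of the invariants, by induction on the derivation of an equality. Together
    -- `reflection` and `exponent` describe the homomorphism onto the semidirect product of ℤ/n by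
    -- ℤ/2; this is the source of all inequalities in `D n`.
    reflection-cong : ∀ {w x} → w ≈ x → reflection w ≡ reflection x
    reflection-cong (relator (here refl)) = reflection-r^ n
    reflection-cong (relator (there (here refl))) = refl
    reflection-cong (relator (there (there (here refl)))) = refl
    reflection-cong reflexive = refl
    reflection-cong (symmetric p) = ≡.sym (reflection-cong p)
    reflection-cong (transitive p q) = ≡.trans (reflection-cong p) (reflection-cong q)
    reflection-cong (∙-cong p q) = cong₂ _xor_ (reflection-cong p) (reflection-cong q)
    reflection-cong (⁻¹-cong p) = reflection-cong p
    reflection-cong (assoc w x y) = Bool.xor-assoc (reflection w) (reflection x) (reflection y)
    reflection-cong (identityˡ w) = refl
    reflection-cong (identityʳ w) = Bool.xor-identityʳ (reflection w)
    reflection-cong (inverseˡ w) = Bool.xor-same (reflection w)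
    reflection-cong (inverseʳ w) = Bool.xor-same (reflection w)

    exponent-cong : ∀ {w x} → w ≈ x → exponent w ≡ exponent x [mod n ]
    exponent-cong (relator (here refl)) = divides (+ 1) (≡.trans (ℤ.+-identityʳ _)
      (≡.trans (exponent-r^ n) (≡.sym (ℤ.*-identityˡ (+ n)))))
    exponent-cong (relator (there (here refl))) = divides (+ 0) refl
    exponent-cong (relator (there (there (here refl)))) = divides (+ 0) refl
    exponent-cong {w} reflexive = mod-reflexive {e = exponent w} refl
    exponent-cong {w} {x} (symmetric p) = mod-sym {e = exponent x} {exponent w} (exponent-cong p)
    exponent-cong {w} {y} (transitive {x = x} p q) =
      mod-trans {e = exponent w} {exponent x} {exponent y} (exponent-cong p) (exponent-cong q)
    exponent-cong (∙-cong {w} {x} {y} {t} p q) rewrite reflection-cong p =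
      mod-+ {e = exponent w} {exponent x} (exponent-cong p)
        (mod-signed (reflection x) {exponent y} {exponent t} (exponent-cong q))
    exponent-cong (⁻¹-cong {w} {x} p) rewrite reflection-cong p =
      mod-neg {e = signed (reflection x) (exponent w)} {signed (reflection x) (exponent x)}
        (mod-signed (reflection x) {exponent w} {exponent x} (exponent-cong p))
    exponent-cong (assoc w x y) = mod-reflexive (lemma (reflection w) (reflection x) (exponent w) (exponent x) (exponent y))
      where
      ff : ∀ e f g → (e ℤ.+ f) ℤ.+ g ≡ e ℤ.+ (f ℤ.+ g)
      ff = solve-∀ℤ
      ft : ∀ e f g → (e ℤ.+ f) ℤ.+ - g ≡ e ℤ.+ (f ℤ.+ - g)
      ft = solve-∀ℤ
      tf : ∀ e f g → (e ℤ.+ - f) ℤ.+ - g ≡ e ℤ.+ - (f ℤ.+ g)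
      tf = solve-∀ℤ
      tt : ∀ e f g → (e ℤ.+ - f) ℤ.+ g ≡ e ℤ.+ - (f ℤ.+ - g)
      tt = solve-∀ℤ
      lemma : ∀ s t e f g → (e ℤ.+ signed s f) ℤ.+ signed (s xor t) g ≡ e ℤ.+ signed s (f ℤ.+ signed t g)
      lemma false false = ff
      lemma false true  = ft
      lemma true  false = tf
      lemma true  true  = tt
    exponent-cong (identityˡ w) = mod-reflexive (ℤ.+-identityˡ (exponent w))
    exponent-cong (identityʳ w) = mod-reflexive (lemma (reflection w) (exponent w))
      where
      lemma : ∀ s e → e ℤ.+ signed s (+ 0) ≡ e
      lemma false = ℤ.+-identityʳ
      lemma true  = ℤ.+-identityʳ
    exponent-cong (inverseˡ w) = mod-reflexive (lemma (reflection w) (exponent w))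
      where
      lemma : ∀ s e → - signed s e ℤ.+ signed s e ≡ + 0
      lemma s e = ℤ.+-inverseˡ (signed s e)
    exponent-cong (inverseʳ w) = mod-reflexive (lemma (reflection w) (exponent w))
      where
      lemma : ∀ s e → e ℤ.+ signed s (- signed s e) ≡ + 0
      lemma false e = ℤ.+-inverseʳ e
      lemma true  e = ≡.trans (cong (λ i → e ℤ.+ i) (cong -_ (ℤ.neg-involutive e))) (ℤ.+-inverseʳ e)

  module NormalForm (n′ : ℕ) where
    private n = suc n′
    open Group (D n) using (_≈_; setoid; ∙-congˡ; ∙-congʳ)
      renaming (refl to ≈-refl; sym to ≈-sym; trans to ≈-trans; reflexive to ≡⇒≈)
    open GroupProperties (D n) using (inverseˡ-unique)
    open SetoidReasoning setoid

    r^n≈ε : r ^ n ≈ ε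
    r^n≈ε = relator (here refl)

    zz≈ε : z ∙ z ≈ ε
    zz≈ε = ≈-trans (∙-congˡ (≈-sym (identityʳ z))) (relator (there (here refl)))

    zrzr≈ε : (z ∙ r) ∙ (z ∙ r) ≈ ε
    zrzr≈ε = ≈-trans (∙-congˡ (≈-sym (identityʳ (z ∙ r)))) (relator (there (there (here refl))))

    ^-+ : ∀ k l → r ^ (k + l) ≈ r ^ k ∙ r ^ l
    ^-+ zero    l = ≈-sym (identityˡ (r ^ l))
    ^-+ (suc k) l = ≈-trans (∙-congˡ (^-+ k l)) (≈-sym (assoc r (r ^ k) (r ^ l)))

    ^-period : ∀ k → r ^ (k * n) ≈ ε
    ^-period zero    = ≈-refl
    ^-period (suc k) = begin
      r ^ (n + k * n)         ≈⟨ ^-+ n (k * n) ⟩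
      r ^ n ∙ r ^ (k * n)     ≈⟨ ∙-cong r^n≈ε (^-period k) ⟩
      ε ∙ ε                   ≈⟨ identityˡ ε ⟩
      ε                       ∎

    ^-% : ∀ k → r ^ k ≈ r ^ (k % n)
    ^-% k = begin
      r ^ k                             ≈⟨ ≡⇒≈ (cong (r ^_) (m≡m%n+[m/n]*n k n)) ⟩
      r ^ (k % n + k / n * n)           ≈⟨ ^-+ (k % n) (k / n * n) ⟩
      r ^ (k % n) ∙ r ^ (k / n * n)     ≈⟨ ∙-congˡ (^-period (k / n)) ⟩
      r ^ (k % n) ∙ ε                   ≈⟨ identityʳ _ ⟩
      r ^ (k % n)                       ∎

    rzr≈z : r ∙ (z ∙ r) ≈ z
    rzr≈z = begin
      r ∙ (z ∙ r)                ≈⟨ identityˡ _ ⟨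
      ε ∙ (r ∙ (z ∙ r))          ≈⟨ ∙-congʳ zz≈ε ⟨
      (z ∙ z) ∙ (r ∙ (z ∙ r))    ≈⟨ assoc z z _ ⟩
      z ∙ (z ∙ (r ∙ (z ∙ r)))    ≈⟨ ∙-congˡ (assoc z r (z ∙ r)) ⟨
      z ∙ ((z ∙ r) ∙ (z ∙ r))    ≈⟨ ∙-congˡ zrzr≈ε ⟩
      z ∙ ε                      ≈⟨ identityʳ z ⟩
      z                          ∎

    -- The relation zr = r⁻¹z with r⁻¹ written as the power n - 1, so that normal forms need only
    -- natural exponents.
    zr≈r^n′z : z ∙ r ≈ r ^ n′ ∙ z
    zr≈r^n′z = begin
      z ∙ r                        ≈⟨ identityˡ _ ⟨
      ε ∙ (z ∙ r)                  ≈⟨ ∙-congʳ r^n≈ε ⟨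
      r ^ n ∙ (z ∙ r)              ≈⟨ ∙-congʳ (≡⇒≈ (cong (r ^_) (ℕ.+-comm 1 n′))) ⟩
      r ^ (n′ + 1) ∙ (z ∙ r)       ≈⟨ ∙-congʳ (^-+ n′ 1) ⟩
      (r ^ n′ ∙ r ^ 1) ∙ (z ∙ r)   ≈⟨ assoc _ _ _ ⟩
      r ^ n′ ∙ (r ^ 1 ∙ (z ∙ r))   ≈⟨ ∙-congˡ (∙-congʳ (identityʳ r)) ⟩
      r ^ n′ ∙ (r ∙ (z ∙ r))       ≈⟨ ∙-congˡ rzr≈z ⟩
      r ^ n′ ∙ z                   ∎

    zr^ : ∀ k → z ∙ r ^ k ≈ r ^ (k * n′) ∙ z
    zr^ zero    = ≈-trans (identityʳ z) (≈-sym (identityˡ z))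
    zr^ (suc k) = begin
      z ∙ (r ∙ r ^ k)                    ≈⟨ assoc z r _ ⟨
      (z ∙ r) ∙ r ^ k                    ≈⟨ ∙-congʳ zr≈r^n′z ⟩
      (r ^ n′ ∙ z) ∙ r ^ k               ≈⟨ assoc _ _ _ ⟩
      r ^ n′ ∙ (z ∙ r ^ k)               ≈⟨ ∙-congˡ (zr^ k) ⟩
      r ^ n′ ∙ (r ^ (k * n′) ∙ z)        ≈⟨ assoc _ _ _ ⟨
      (r ^ n′ ∙ r ^ (k * n′)) ∙ z        ≈⟨ ∙-congʳ (^-+ n′ (k * n′)) ⟨
      r ^ (n′ + k * n′) ∙ z              ∎

    HasNormalForm : Dih → Set
    HasNormalForm w = ∃₂ λ k s → w ≈ r ^ k ∙ z^ s

    z∙z^ : ∀ s → z ∙ z^ s ≈ z^ (true xor s)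
    z∙z^ false = identityʳ z
    z∙z^ true  = zz≈ε

    reflection-∙ : ∀ k l s → (r ^ k ∙ z) ∙ (r ^ l ∙ z^ s) ≈ r ^ (k + l * n′) ∙ z^ (true xor s)
    reflection-∙ k l s = begin
      (r ^ k ∙ z) ∙ (r ^ l ∙ z^ s)               ≈⟨ assoc _ _ _ ⟩
      r ^ k ∙ (z ∙ (r ^ l ∙ z^ s))               ≈⟨ ∙-congˡ (assoc _ _ _) ⟨
      r ^ k ∙ ((z ∙ r ^ l) ∙ z^ s)               ≈⟨ ∙-congˡ (∙-congʳ (zr^ l)) ⟩
      r ^ k ∙ ((r ^ (l * n′) ∙ z) ∙ z^ s)        ≈⟨ ∙-congˡ (assoc _ _ _) ⟩
      r ^ k ∙ (r ^ (l * n′) ∙ (z ∙ z^ s))        ≈⟨ ∙-congˡ (∙-congˡ (z∙z^ s)) ⟩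
      r ^ k ∙ (r ^ (l * n′) ∙ z^ (true xor s))   ≈⟨ assoc _ _ _ ⟨
      (r ^ k ∙ r ^ (l * n′)) ∙ z^ (true xor s)   ≈⟨ ∙-congʳ (^-+ k (l * n′)) ⟨
      r ^ (k + l * n′) ∙ z^ (true xor s)         ∎

    rotation-∙ : ∀ k l s → (r ^ k ∙ ε) ∙ (r ^ l ∙ z^ s) ≈ r ^ (k + l) ∙ z^ s
    rotation-∙ k l s = begin
      (r ^ k ∙ ε) ∙ (r ^ l ∙ z^ s)   ≈⟨ ∙-congʳ (identityʳ _) ⟩
      r ^ k ∙ (r ^ l ∙ z^ s)         ≈⟨ assoc _ _ _ ⟨
      (r ^ k ∙ r ^ l) ∙ z^ s         ≈⟨ ∙-congʳ (^-+ k l) ⟨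
      r ^ (k + l) ∙ z^ s             ∎

    normalForm : ∀ w → HasNormalForm w
    normalForm (gen ρ) = 1 , false , ≈-trans (≈-sym (identityʳ r)) (≈-sym (identityʳ _))
    normalForm (gen ζ) = 0 , true , ≈-sym (identityˡ z)
    normalForm ε       = 0 , false , ≈-sym (identityˡ ε)
    normalForm (w ∙ x) with normalForm w | normalForm x
    ... | k , false , p | l , t , q = k + l , t , ≈-trans (∙-cong p q) (rotation-∙ k l t)
    ... | k , true  , p | l , t , q = k + l * n′ , true xor t , ≈-trans (∙-cong p q) (reflection-∙ k l t)
    normalForm (w ⁻¹) with normalForm w
    -- A reflection is its own inverse: in its square the exponents k and k(n - 1) add up to a
    -- multiple of n.
    ... | k , true  , p = k , true , ≈-trans (≈-sym (inverseˡ-unique w w (begin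
      w ∙ w                          ≈⟨ ∙-cong p p ⟩
      (r ^ k ∙ z) ∙ (r ^ k ∙ z)      ≈⟨ reflection-∙ k k true ⟩
      r ^ (k + k * n′) ∙ ε           ≈⟨ identityʳ _ ⟩
      r ^ (k + k * n′)               ≈⟨ ≡⇒≈ (cong (r ^_) (ℕ.*-suc k n′)) ⟨
      r ^ (k * n)                    ≈⟨ ^-period k ⟩
      ε                              ∎))) p
    ... | k , false , p = k * n′ , false , ≈-trans (≈-sym (inverseˡ-unique (r ^ (k * n′)) w (begin
      r ^ (k * n′) ∙ w               ≈⟨ ∙-congˡ (≈-trans p (identityʳ _)) ⟩
      r ^ (k * n′) ∙ r ^ k           ≈⟨ ^-+ (k * n′) k ⟨
      r ^ (k * n′ + k)               ≈⟨ ≡⇒≈ (cong (r ^_) (≡.trans (ℕ.*-suc k n′) (ℕ.+-comm k (k * n′)))) ⟨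
      r ^ (k * n)                    ≈⟨ ^-period k ⟩
      ε                              ∎))) (≈-sym (identityʳ _))

    r^-cong : ∀ k l → + k ≡ + l [mod n ] → r ^ k ≈ r ^ l
    r^-cong k l p = ≈-trans (^-% k) (≈-trans (≡⇒≈ (cong (r ^_) (mod⇒%≡% k l p))) (≈-sym (^-% l)))

    -- Completeness of the invariants: a normal form is recovered from its two coordinates.
    -- Equalities in `X n` can then be verified on coordinates, often by evaluation alone.
    coordinates-complete : ∀ {w x} → reflection w ≡ reflection x → exponent w ≡ exponent x [mod n ] → w ≈ x
    coordinates-complete {w} {x} s≡t e≡f with normalForm w | normalForm x
    ... | k , s , p | l , t , q =
      ≈-trans p (≈-trans (∙-cong (r^-cong k l k≡l) (≡⇒≈ (cong z^_ s≡t′))) (≈-sym q))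
      where
      s≡t′ : s ≡ t
      s≡t′ = ≡.trans (≡.sym (reflection-rz k s)) (≡.trans (≡.sym (reflection-cong p))
               (≡.trans s≡t (≡.trans (reflection-cong q) (reflection-rz l t))))
      k≡l : + k ≡ + l [mod n ]
      k≡l = ≡.subst₂ (_≡_[mod n ]) (exponent-rz k s) (exponent-rz l t)
        (mod-trans {e = exponent (r ^ k ∙ z^ s)} {exponent w} {exponent (r ^ l ∙ z^ t)}
          (mod-sym {e = exponent w} {exponent (r ^ k ∙ z^ s)} (exponent-cong p))
          (mod-trans {e = exponent w} {exponent x} {exponent (r ^ l ∙ z^ t)} e≡f (exponent-cong q)))

    rz : Bool × Fin n → Dih
    rz (s , i) = r ^ toℕ i ∙ z^ s

    rz-injective : ∀ {p q} → rz p ≈ rz q → p ≡ q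
    rz-injective {s , i} {t , j} p = cong₂ _,_
      (≡.trans (≡.sym (reflection-rz (toℕ i) s)) (≡.trans (reflection-cong p) (reflection-rz (toℕ j) t)))
      (toℕ-injective (≡.trans (≡.sym (m<n⇒m%n≡m (toℕ<n i)))
        (≡.trans (mod⇒%≡% (toℕ i) (toℕ j)
            (≡.subst₂ (_≡_[mod n ]) (exponent-rz (toℕ i) s) (exponent-rz (toℕ j) t) (exponent-cong p)))
          (m<n⇒m%n≡m (toℕ<n j)))))

    rz-surjective : ∀ w → ∃ λ p → rz p ≈ w
    rz-surjective w with normalForm w
    ... | k , s , p = (s , k mod n) ,
      ≈-trans (∙-congʳ (≈-trans (≡⇒≈ (cong (r ^_) (toℕ-fromℕ< (m%n<n k n)))) (≈-sym (^-% k)))) (≈-sym p)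

open DihedralGroup using (Dih; reflection; exponent; _≡_[mod_]; mod-reflexive; reflection-cong; exponent-cong;
  module NormalForm)

-- The symmetric group on three points

-- The images of 0 and 1 determine a permutation of three points; it is even
-- if and only if 1 is mapped to the cyclic successor of the image of 0.

next : Fin 3 → Fin 3
next 0F = 1F
next 1F = 2F
next 2F = 0F

oddPair : Fin 3 → Fin 3 → Bool
oddPair i j = not (does (j ≟ next i))

odd : Permutation′ 3 → Bool
odd π = oddPair (π ⟨$⟩ʳ 0F) (π ⟨$⟩ʳ 1F)

rotation : Fin 3 → Permutation′ 3
rotation 0F = Perm.id
rotation 1F = transpose 0F 1F ∘ₚ transpose 0F 2F
rotation 2F = transpose 0F 2F ∘ₚ transpose 0F 1F

-- `rotation k` is even and sends 0 to k. The transposition applied first in the odd case fixes 0,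
-- so the pair is always the sign together with the image of 0.
permutation : Bool × Fin 3 → Permutation′ 3
permutation (false , k) = rotation k
permutation (true  , k) = transpose 1F 2F ∘ₚ rotation k

⟨$⟩ʳ-injective : ∀ {n} (π : Permutation′ n) {i j} → π ⟨$⟩ʳ i ≡ π ⟨$⟩ʳ j → i ≡ j
⟨$⟩ʳ-injective π = Injection.injective (↔⇒↣ π)

permutation-injective : ∀ {p q} → permutation p Perm.≈ permutation q → p ≡ q
permutation-injective {s , k} {t , l} p = cong₂ _,_
  (≡.trans (≡.sym (odd-permutation s k)) (≡.trans (cong₂ oddPair (p 0F) (p 1F)) (odd-permutation t l)))
  (≡.trans (≡.sym (permutation-0 s k)) (≡.trans (p 0F) (permutation-0 t l)))
  where
  odd-permutation : ∀ s k → odd (permutation (s , k)) ≡ s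
  odd-permutation false 0F = refl
  odd-permutation false 1F = refl
  odd-permutation false 2F = refl
  odd-permutation true  0F = refl
  odd-permutation true  1F = refl
  odd-permutation true  2F = refl

  permutation-0 : ∀ s k → permutation (s , k) ⟨$⟩ʳ 0F ≡ k
  permutation-0 false 0F = refl
  permutation-0 false 1F = refl
  permutation-0 false 2F = refl
  permutation-0 true  0F = refl
  permutation-0 true  1F = refl
  permutation-0 true  2F = refl

permutation-surjective : ∀ π → permutation (odd π , π ⟨$⟩ʳ 0F) Perm.≈ π
permutation-surjective π i = ≡.trans
  (table (π ⟨$⟩ʳ 0F) (π ⟨$⟩ʳ 1F) (π ⟨$⟩ʳ 2F)
    (λ p → contradiction (⟨$⟩ʳ-injective π p) λ ())
    (λ p → contradiction (⟨$⟩ʳ-injective π p) λ ())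
    (λ p → contradiction (⟨$⟩ʳ-injective π p) λ ()) i)
  (pointwise i)
  where
  triple : Fin 3 → Fin 3 → Fin 3 → Fin 3 → Fin 3
  triple i j k 0F = i
  triple i j k 1F = j
  triple i j k 2F = k

  table : ∀ i j k → i ≢ j → i ≢ k → j ≢ k → ∀ l → permutation (oddPair i j , i) ⟨$⟩ʳ l ≡ triple i j k l
  table = from-yes (all? λ i → all? λ j → all? λ k → ¬? (i ≟ j) →-dec ¬? (i ≟ k) →-dec ¬? (j ≟ k) →-dec
    all? λ l → permutation (oddPair i j , i) ⟨$⟩ʳ l ≟ triple i j k l)

  pointwise : ∀ i → triple (π ⟨$⟩ʳ 0F) (π ⟨$⟩ʳ 1F) (π ⟨$⟩ʳ 2F) i ≡ π ⟨$⟩ʳ i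
  pointwise 0F = refl
  pointwise 1F = refl
  pointwise 2F = refl

open Dihedral using (r; z)

-- The groups `D n` share one set of words as carrier, so the generators are defined without n.
colour : Letter → Permutation′ 3 × Presentation.Word
colour 0F = transpose 0F 1F , Presentation.ε
colour 1F = transpose 0F 2F , z
colour 2F = transpose 1F 2F , z Presentation.∙ r

-- Groups generated by three involutions

module _ (𝔾 : Group 0ℓ 0ℓ) where

  open Group 𝔾 using (Carrier; _≈_; _∙_; ε; setoid)

  module ColouredGroup
    (_~_ : Rel Carrier 0ℓ) (~-resp-≈ : _~_ Respects₂ _≈_) (~-sym : Symmetric _~_) (~-irrefl : Irreflexive _≈_ _~_)
    (colour : Letter → Carrier)
    (colour-involutive : ∀ s → (colour s ∙ colour s) ≈ ε)
    (colour-injective : ∀ {s t} → colour s ≈ colour t → s ≡ t)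
    (~-colour : ∀ x s → x ~ (x ∙ colour s))
    (~⇒colour : ∀ {x y} → x ~ y → ∃ λ s → y ≈ (x ∙ colour s) ⊎ x ≈ (y ∙ colour s))
    where

    open Group 𝔾 using (_⁻¹; assoc; identityˡ; identityʳ; inverseˡ; inverseʳ; ∙-congˡ; ∙-congʳ; refl; sym; trans; reflexive)
    open GroupProperties 𝔾 using (∙-cancelˡ)

    graph : Graph
    graph = record { vertices = setoid ; _~_ = _~_ ; ~-resp-≈ = ~-resp-≈ ; ~-sym = ~-sym ; ~-irrefl = ~-irrefl }

    infixl 7 _·_
    _·_ : Carrier → Letter → Carrier
    x · s = x ∙ colour s

    ·-cong : ∀ {x y} s → x ≈ y → (x · s) ≈ (y · s)
    ·-cong s = ∙-congʳ

    ·-involutive : ∀ x s → (x · s · s) ≈ x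
    ·-involutive x s = trans (assoc x (colour s) (colour s)) (trans (∙-congˡ (colour-involutive s)) (identityʳ x))

    ·-injective : ∀ x {s t} → (x · s) ≈ (x · t) → s ≡ t
    ·-injective x p = colour-injective (∙-cancelˡ x _ _ p)

    ·-swap : ∀ {x y} s → x ≈ (y · s) → y ≈ (x · s)
    ·-swap {x} {y} s p = trans (sym (·-involutive y s)) (·-cong s (sym p))

    ~⇒· : ∀ {x y} → x ~ y → ∃ λ s → y ≈ (x · s)
    ~⇒· p with ~⇒colour p
    ... | s , inj₁ q = s , q
    ... | s , inj₂ q = s , ·-swap s q

    open Coloured graph _·_ ·-cong ~-colour ~⇒· ·-involutive ·-injective public

    ⟦_⟧ : Word → Carrier
    ⟦ [] ⟧    = ε
    ⟦ s ∷ w ⟧ = colour s ∙ ⟦ w ⟧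

    walk-⟦⟧ : ∀ x w → walk x w ≈ (x ∙ ⟦ w ⟧)
    walk-⟦⟧ x []      = sym (identityʳ x)
    walk-⟦⟧ x (s ∷ w) = trans (walk-⟦⟧ (x · s) w) (assoc x (colour s) ⟦ w ⟧)

    walk-closed⇔ : ∀ x w → walk x w ≈ x ⇔ ⟦ w ⟧ ≈ ε
    walk-closed⇔ x w = mk⇔
      (λ p → ∙-cancelˡ x _ _ (trans (sym (walk-⟦⟧ x w)) (trans p (sym (identityʳ x)))))
      (λ p → trans (walk-⟦⟧ x w) (trans (∙-congˡ p) (identityʳ x)))

    translation : Carrier → graph ≅ graph
    translation g = record
      { bijection = record
        { to        = g ∙_
        ; from      = g ⁻¹ ∙_
        ; to-cong   = ∙-congˡ
        ; from-cong = ∙-congˡ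
        ; inverse   = (λ {x} p → trans (∙-congˡ p) (cancel g (g ⁻¹) x (inverseʳ g))) ,
                      (λ {x} p → trans (∙-congˡ p) (cancel (g ⁻¹) g x (inverseˡ g)))
        }
      ; ~-iff = λ x y → mk⇔ (translate g) λ p →
          ~-resp-≈ .proj₁ (cancel (g ⁻¹) g y (inverseˡ g))
            (~-resp-≈ .proj₂ (cancel (g ⁻¹) g x (inverseˡ g)) (translate (g ⁻¹) p))
      }
      where
      cancel : ∀ g h x → (g ∙ h) ≈ ε → (g ∙ (h ∙ x)) ≈ x
      cancel g h x p = trans (sym (assoc g h x)) (trans (∙-congʳ p) (identityˡ x))

      translate : ∀ g {x y} → x ~ y → (g ∙ x) ~ (g ∙ y)
      translate g {x} p = let s , y≈ = ~⇒· p in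
        ~-resp-≈ .proj₁ (trans (assoc g x (colour s)) (∙-congˡ (sym y≈))) (~-colour (g ∙ x) s)

    vertexTransitive : VertexTransitive graph
    vertexTransitive x y = translation (y ∙ x ⁻¹) ,
      trans (assoc y (x ⁻¹) x) (trans (∙-congˡ (inverseˡ x)) (identityʳ y))

    cubic : Cubic graph
    cubic = neighbours Perm.id

    -- Quantifying over the start makes the reachable elements a subgroup: walks can be concatenated
    -- and reversed wherever they begin.
    Reachable : Carrier → Set
    Reachable g = ∀ x → Star (_≈_ ∪ _~_) x (x ∙ g)

    reachable-resp : ∀ {g h} → g ≈ h → Reachable g → Reachable h
    reachable-resp g≈h p x = p x ◅◅ (inj₁ (∙-congˡ g≈h) ◅ Star.ε)

    reachable-∙ : ∀ {g h} → Reachable g → Reachable h → Reachable (g ∙ h)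
    reachable-∙ {g} {h} p q x = p x ◅◅ q (x ∙ g) ◅◅ (inj₁ (assoc x g h) ◅ Star.ε)

    reachable-⁻¹ : ∀ {g} → Reachable g → Reachable (g ⁻¹)
    reachable-⁻¹ {g} p x =
      inj₁ (sym (trans (assoc x (g ⁻¹) g) (trans (∙-congˡ (inverseˡ g)) (identityʳ x)))) ◅
      Star.reverse (λ { (inj₁ p) → inj₁ (sym p) ; (inj₂ e) → inj₂ (~-sym e) }) (p (x ∙ g ⁻¹))

    reachable-⟦⟧ : ∀ w → Reachable ⟦ w ⟧
    reachable-⟦⟧ []      x = inj₁ (sym (identityʳ x)) ◅ Star.ε
    reachable-⟦⟧ (s ∷ w) = reachable-∙ (λ x → inj₂ (~-colour x s) ◅ Star.ε) (reachable-⟦⟧ w)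

    reachable⇒connected : (∀ g → Reachable g) → Connected graph
    reachable⇒connected reachable x y = reachable (x ⁻¹ ∙ y) x ◅◅
      (inj₁ (trans (sym (assoc x (x ⁻¹) y)) (trans (∙-congʳ (inverseʳ x)) (identityˡ y))) ◅ Star.ε)

    -- The path ε, b, bc, bcb, … extended on the left: statements about all its
    -- vertices then reduce to the first two by cancellation.
    path : ℕ → Carrier
    path 0             = ε
    path 1             = colour 1F
    path (suc (suc i)) = (colour 1F ∙ colour 2F) ∙ path i

    alternate : Letter → Letter → ℕ → Letter
    alternate s t 0             = s
    alternate s t 1             = t
    alternate s t (suc (suc i)) = alternate s t i

    path-suc : ∀ i → (path i · alternate 1F 2F i) ≈ path (suc i)
    path-suc 0             = identityˡ (colour 1F)
    path-suc 1             = sym (identityʳ (colour 1F ∙ colour 2F))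
    path-suc (suc (suc i)) = trans (assoc _ (path i) _) (∙-congˡ (path-suc i))

    path-chord : ∀ k s t → (path k · 0F · s) ≈ (path 0 · 0F) → (path (suc k) · 0F · t) ≈ (path 1 · 0F) →
                 ∀ i → (path (i + k) · 0F · alternate s t i) ≈ (path i · 0F)
    path-chord k s t p q 0             = p
    path-chord k s t p q 1             = q
    path-chord k s t p q (suc (suc i)) =
      trans (∙-congʳ (assoc _ (path (i + k)) (colour 0F)))
        (trans (assoc _ (path (i + k) · 0F) _)
          (trans (∙-congˡ (path-chord k s t p q i)) (sym (assoc _ (path i) (colour 0F)))))

    -- Cancelling factors bc on the left leads down to the start 0 or 1, according to the parity of
    -- i. Hence the hypotheses of `Petersen` come in pairs.
    path-cancel : ∀ i d h → path (i + d) ≈ (path i ∙ h) → path d ≈ (path 0 ∙ h) ⊎ path (suc d) ≈ (path 1 ∙ h)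
    path-cancel 0             d h p = inj₁ p
    path-cancel 1             d h p = inj₂ p
    path-cancel (suc (suc i)) d h p = path-cancel i d h (∙-cancelˡ _ _ _ (trans p (assoc _ (path i) h)))

    -- The path is the outer rim and its a-neighbours are the inner vertices. `return` makes the rim
    -- injective, `apart` separates it from the inner vertices, the chords supply the inner edges,
    -- and `order` makes the resulting injection a bijection by counting.
    module Petersen (m k : ℕ) (1≤k : 1 ≤ k) (2k<m : 2 * k < m)
      (period₀ : path m ≈ path 0) (period₁ : path (suc m) ≈ path 1)
      (s t : Letter)
      (chord₀ : (path k · 0F · s) ≈ (path 0 · 0F)) (chord₁ : (path (suc k) · 0F · t) ≈ (path 1 · 0F))
      (return₀ : ∀ d → path d ≈ (path 0 ∙ ε) → m ∣ d) (return₁ : ∀ d → path (suc d) ≈ (path 1 ∙ ε) → m ∣ d)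
      (apart₀ : ∀ d → ¬ path d ≈ (path 0 ∙ colour 0F)) (apart₁ : ∀ d → ¬ path (suc d) ≈ (path 1 ∙ colour 0F))
      (order : HasCardinality setoid (m + m))
      where

      open GPNeighbours 1≤k 2k<m

      path-periodic : ∀ i → path (i + m) ≈ path i
      path-periodic 0             = period₀
      path-periodic 1             = period₁
      path-periodic (suc (suc i)) = ∙-congˡ (path-periodic i)

      path-periods : ∀ i q → path (i + q * m) ≈ path i
      path-periods i zero    = reflexive (cong path (ℕ.+-identityʳ i))
      path-periods i (suc q) = trans
        (reflexive (cong path (≡.trans (cong (i +_) (ℕ.+-comm m (q * m))) (≡.sym (ℕ.+-assoc i (q * m) m)))))
        (trans (path-periodic (i + q * m)) (path-periods i q))

      path-⊕ : ∀ (i : Fin m) j → path (toℕ (i ⊕ j)) ≈ path (toℕ i + j)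
      -- `_⊕_` unfolds only at a successor, so the modulus is generalised before it is split.
      path-⊕ i j = go m ≡.refl i
        where
        go : ∀ m′ → m′ ≡ m → (i : Fin m′) → path (toℕ (i ⊕ j)) ≈ path (toℕ i + j)
        go (suc m′) ≡.refl i = trans (reflexive (cong path (toℕ-⊕ i j)))
          (trans (sym (path-periods ((toℕ i + j) % m) ((toℕ i + j) / m)))
            (reflexive (cong path (≡.sym (m≡m%n+[m/n]*n (toℕ i + j) m)))))

      vertex : GPVertex m → Carrier
      vertex (u i) = path (toℕ i)
      vertex (v i) = path (toℕ i) · 0F

      vertex-edge : ∀ {x y} → GPEdge m k x y → vertex x ~ vertex y
      vertex-edge (outer i) = ~-resp-≈ .proj₁
        (trans (path-suc (toℕ i)) (trans (reflexive (cong path (ℕ.+-comm 1 (toℕ i)))) (sym (path-⊕ i 1))))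
        (~-colour (path (toℕ i)) _)
      vertex-edge (spoke i) = ~-colour (path (toℕ i)) 0F
      vertex-edge (inner i) = ~-resp-≈ .proj₁ (·-cong 0F (sym (path-⊕ i k)))
        (~-sym (~-resp-≈ .proj₁ (path-chord k s t chord₀ chord₁ (toℕ i)) (~-colour (path (toℕ i + k) · 0F) _)))

      vertex-~ : ∀ {x y} → SymClosure (GPEdge m k) x y → vertex x ~ vertex y
      vertex-~ (fwd e) = vertex-edge e
      vertex-~ (bwd e) = ~-sym (vertex-edge e)

      path-≉ : ∀ i j → i < j → j < m → ¬ path j ≈ path i
      path-≉ i j i<j j<m p = contradiction
        (∣⇒≤ {{>-nonZero (ℕ.m<n⇒0<n∸m i<j)}} m∣d)
        (<⇒≱ (ℕ.≤-<-trans (ℕ.m∸n≤m j i) j<m))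
        where
        m∣d : m ∣ j ∸ i
        m∣d with path-cancel i (j ∸ i) ε (trans (reflexive (cong path (ℕ.m+[n∸m]≡n (ℕ.<⇒≤ i<j))))
          (trans p (sym (identityʳ (path i)))))
        ... | inj₁ q = return₀ (j ∸ i) q
        ... | inj₂ q = return₁ (j ∸ i) q

      path-apart : ∀ i j → i ≤ j → ¬ path j ≈ (path i · 0F)
      path-apart i j i≤j p
        with path-cancel i (j ∸ i) (colour 0F) (trans (reflexive (cong path (ℕ.m+[n∸m]≡n i≤j))) p)
      ... | inj₁ q = apart₀ (j ∸ i) q
      ... | inj₂ q = apart₁ (j ∸ i) q

      path-injective : ∀ {i j : Fin m} → path (toℕ i) ≈ path (toℕ j) → i ≡ j
      path-injective {i} {j} p with ℕ.<-cmp (toℕ i) (toℕ j)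
      ... | tri≈ _ i≡j _ = toℕ-injective i≡j
      ... | tri< i<j _ _ = contradiction (sym p) (path-≉ _ _ i<j (toℕ<n j))
      ... | tri> _ _ j<i = contradiction p (path-≉ _ _ j<i (toℕ<n i))

      path-spoke : ∀ i j → ¬ path i ≈ (path j · 0F)
      path-spoke i j p with ℕ.≤-total i j
      ... | inj₁ i≤j = path-apart i j i≤j (·-swap 0F p)
      ... | inj₂ j≤i = path-apart j i j≤i p

      vertex-injective : ∀ {x y} → vertex x ≈ vertex y → x ≡ y
      vertex-injective {u i} {u j} p = cong u (path-injective p)
      vertex-injective {u i} {v j} p = contradiction p (path-spoke (toℕ i) (toℕ j))
      vertex-injective {v i} {u j} p = contradiction (sym p) (path-spoke (toℕ j) (toℕ i))
      vertex-injective {v i} {v j} p = cong v (path-injective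
        (trans (sym (·-involutive (path (toℕ i)) 0F)) (trans (·-cong 0F p) (·-involutive (path (toℕ j)) 0F))))

      vertex-surjective : ∀ x → ∃ λ y → vertex y ≈ x
      vertex-surjective x with injective⇒surjective
        (λ i → from order (vertex (to (GPVertex↔Fin m) i)))
        (λ p → Injection.injective (↔⇒↣ (GPVertex↔Fin m)) (vertex-injective (from-injective p)))
        (from order x)
        where
        open Inverse
        from-injective : ∀ {x y} → from order x ≡ from order y → x ≈ y
        from-injective p = trans (sym (strictlyInverseˡ order _)) (trans (to-cong order p) (strictlyInverseˡ order _))
      ... | i , p = to (GPVertex↔Fin m) i ,
        trans (sym (strictlyInverseˡ order _)) (trans (to-cong order p) (strictlyInverseˡ order x))
        where open Inverse

      -- Both graphs are cubic, so an injection preserving edges reflects them.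
      vertex-~⁻ : ∀ x y → vertex x ~ vertex y → SymClosure (GPEdge m k) x y
      vertex-~⁻ x y e =
        let s , y≈xs = ~⇒· e
            i , letterᵢ≡s = injective⇒surjective letter letter-injective s
        in subst (SymClosure (GPEdge m k) x)
             (vertex-injective (trans (letter-≈ i) (trans (reflexive (cong (vertex x ·_) letterᵢ≡s)) (sym y≈xs))))
             (neighbour-edge x i)
        where
        letter : Letter → Letter
        letter i = ~⇒· (vertex-~ (neighbour-edge x i)) .proj₁

        letter-≈ : ∀ i → vertex (neighbour x i) ≈ (vertex x · letter i)
        letter-≈ i = ~⇒· (vertex-~ (neighbour-edge x i)) .proj₂

        letter-injective : ∀ {i j} → letter i ≡ letter j → i ≡ j
        letter-injective {i} {j} p = neighbour-injective x (vertex-injective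
          (trans (letter-≈ i) (trans (reflexive (cong (vertex x ·_) p)) (sym (letter-≈ j)))))

      graph≅GP : ∀ p q → graph ≅ GP m k p q
      graph≅GP p q = ≅-sym {GP m k p q} {graph} record
        { bijection = bijective⇒inverse {S = setoid} vertex vertex-injective vertex-surjective
        ; ~-iff     = λ x y → mk⇔ vertex-~ (vertex-~⁻ x y)
        }

-- The graph `X n`: coordinates, order and connectedness

module CayleyGraph (n′ : ℕ) where

  n = suc n′
  private module S₃×D = Group (S₃×D n)
  open Graph (X n) using (V; _≈_; _~_) public
  open NormalForm n′ using (coordinates-complete; rz; rz-injective; rz-surjective)

  byCoordinates : ∀ (x y : V) → (∀ i → x .proj₁ ⟨$⟩ʳ i ≡ y .proj₁ ⟨$⟩ʳ i) →
    reflection (x .proj₂) ≡ reflection (y .proj₂) → exponent (x .proj₂) ≡ exponent (y .proj₂) [mod n ] → x ≈ y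
  byCoordinates x y p q e = p , coordinates-complete q e

  byComputation : ∀ (x y : V) → (∀ i → x .proj₁ ⟨$⟩ʳ i ≡ y .proj₁ ⟨$⟩ʳ i) →
    reflection (x .proj₂) ≡ reflection (y .proj₂) → exponent (x .proj₂) ≡ exponent (y .proj₂) → x ≈ y
  byComputation x y p q e = byCoordinates x y p q (mod-reflexive e)

  colour-involutive : ∀ s → colour s S₃×D.∙ colour s ≈ S₃×D.ε
  colour-involutive s@0F = byComputation (colour s S₃×D.∙ colour s) S₃×D.ε
    (λ { 0F → refl ; 1F → refl ; 2F → refl }) refl refl
  colour-involutive s@1F = byComputation (colour s S₃×D.∙ colour s) S₃×D.ε
    (λ { 0F → refl ; 1F → refl ; 2F → refl }) refl refl
  colour-involutive s@2F = byComputation (colour s S₃×D.∙ colour s) S₃×D.ε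
    (λ { 0F → refl ; 1F → refl ; 2F → refl }) refl refl

  colour-injective : ∀ {s t} → colour s ≈ colour t → s ≡ t
  colour-injective {s} {t} (p , _) =
    -- The transpositions of a, b, c send 0 to 1, 2, 0; as a function of the letter this is a
    -- 3-cycle, so the image of 0 reveals the letter.
    ⟨$⟩ʳ-injective (rotation 1F) (≡.trans (≡.sym (image s)) (≡.trans (p 0F) (image t)))
    where
    image : ∀ s → colour s .proj₁ ⟨$⟩ʳ 0F ≡ rotation 1F ⟨$⟩ʳ s
    image 0F = refl
    image 1F = refl
    image 2F = refl

  ~-colour : ∀ x s → x ~ (x S₃×D.∙ colour s)
  ~-colour x 0F = fwd (here (S₃×D.refl {x S₃×D.∙ colour 0F}))
  ~-colour x 1F = fwd (there (here (S₃×D.refl {x S₃×D.∙ colour 1F})))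
  ~-colour x 2F = fwd (there (there (here (S₃×D.refl {x S₃×D.∙ colour 2F}))))

  ~⇒colour : ∀ {x y} → x ~ y → ∃ λ s → y ≈ (x S₃×D.∙ colour s) ⊎ x ≈ (y S₃×D.∙ colour s)
  ~⇒colour (fwd (here p))                 = 0F , inj₁ p
  ~⇒colour (fwd (there (here p)))         = 1F , inj₁ p
  ~⇒colour (fwd (there (there (here p)))) = 2F , inj₁ p
  ~⇒colour (bwd (here p))                 = 0F , inj₂ p
  ~⇒colour (bwd (there (here p)))         = 1F , inj₂ p
  ~⇒colour (bwd (there (there (here p)))) = 2F , inj₂ p

  open ColouredGroup (S₃×D n) _~_ (Graph.~-resp-≈ (X n)) (Graph.~-sym (X n)) (Graph.~-irrefl (X n))
    colour colour-involutive colour-injective ~-colour ~⇒colour public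

  coordinates : Inverse (≡.setoid ((Bool × Fin 3) × (Bool × Fin n))) (Graph.vertices (X n))
  coordinates = bijective⇒inverse {S = Graph.vertices (X n)}
    (λ (p , q) → permutation p , rz q)
    (λ (p , q) → cong₂ _,_ (permutation-injective p) (rz-injective q))
    (λ (π , w) → ((odd π , π ⟨$⟩ʳ 0F) , rz-surjective w .proj₁) , permutation-surjective π , rz-surjective w .proj₂)

  hasOrder : HasOrder (X n) (12 * n)
  hasOrder = split ∘-inverse coordinates
    where
    Bool×Fin : ∀ k → Fin (2 * k) ↔ (Bool × Fin k)
    Bool×Fin k = (2↔Bool ×-↔ ↔-id (Fin k)) ↔-∘ *↔×

    arith : ∀ n → 12 * n ≡ 6 * (2 * n)
    arith = solve-∀

    split : Fin (12 * n) ↔ ((Bool × Fin 3) × (Bool × Fin n))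
    split = (Bool×Fin 3 ×-↔ Bool×Fin n) ↔-∘ (*↔× ↔-∘ Perm.cast-id (arith n))

  -- Both ab and ac act as 3-cycles on the points, while their dihedral parts z and zr are
  -- involutions. The cubes are therefore (1,z) and (1,zr), with product (1,r): the walks reach all
  -- of the dihedral factor, and then S₃ by removing the dihedral parts of b and c.
  [ab]³ [ac]³ : Word
  [ab]³ = 0F ∷ 1F ∷ 0F ∷ 1F ∷ 0F ∷ 1F ∷ []
  [ac]³ = 0F ∷ 2F ∷ 0F ∷ 2F ∷ 0F ∷ 2F ∷ []

  private module P = Presentation {Dihedral.Generator}

  reachable-computed : ∀ g h → (∀ i → g .proj₁ ⟨$⟩ʳ i ≡ h .proj₁ ⟨$⟩ʳ i) →
    reflection (g .proj₂) ≡ reflection (h .proj₂) → exponent (g .proj₂) ≡ exponent (h .proj₂) →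
    Reachable g → Reachable h
  reachable-computed g h p q e = reachable-resp {g} {h} (byComputation g h p q e)

  reachable-dihedral : ∀ w → Reachable (Perm.id , w)
  reachable-dihedral (P.gen Dihedral.ρ) =
    reachable-computed (⟦ [ab]³ ⟧ S₃×D.∙ ⟦ [ac]³ ⟧) (Perm.id , r) (λ { 0F → refl ; 1F → refl ; 2F → refl }) refl refl
      (reachable-∙ {⟦ [ab]³ ⟧} {⟦ [ac]³ ⟧} (reachable-⟦⟧ [ab]³) (reachable-⟦⟧ [ac]³))
  reachable-dihedral (P.gen Dihedral.ζ) =
    reachable-computed ⟦ [ab]³ ⟧ (Perm.id , z) (λ { 0F → refl ; 1F → refl ; 2F → refl }) refl refl (reachable-⟦⟧ [ab]³)
  reachable-dihedral P.ε       = reachable-⟦⟧ []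
  reachable-dihedral (w P.∙ x) =
    reachable-computed ((Perm.id , w) S₃×D.∙ (Perm.id , x)) (Perm.id , w P.∙ x) (λ _ → refl) refl refl
      (reachable-∙ {Perm.id , w} {Perm.id , x} (reachable-dihedral w) (reachable-dihedral x))
  reachable-dihedral (w P.⁻¹)  = reachable-computed ((Perm.id , w) S₃×D.⁻¹) (Perm.id , w P.⁻¹) (λ _ → refl) refl refl
    (reachable-⁻¹ {Perm.id , w} (reachable-dihedral w))

  reachable-∘ₚ : ∀ π σ → Reachable (π , P.ε) → Reachable (σ , P.ε) → Reachable (π ∘ₚ σ , P.ε)
  reachable-∘ₚ π σ p q = reachable-computed ((π , P.ε) S₃×D.∙ (σ , P.ε)) (π ∘ₚ σ , P.ε) (λ _ → refl) refl refl
    (reachable-∙ {π , P.ε} {σ , P.ε} p q)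

  reachable-permutation : ∀ p → Reachable (permutation p , P.ε)
  reachable-permutation (s , k) = flipped s k
    where
    t₀₁ : Reachable (transpose 0F 1F , P.ε)
    t₀₁ = reachable-computed ⟦ 0F ∷ [] ⟧ (transpose 0F 1F , P.ε)
        (λ { 0F → refl ; 1F → refl ; 2F → refl }) refl refl (reachable-⟦⟧ (0F ∷ []))
    t₀₂ : Reachable (transpose 0F 2F , P.ε)
    t₀₂ = reachable-computed ⟦ 1F ∷ [ab]³ ⟧ (transpose 0F 2F , P.ε)
        (λ { 0F → refl ; 1F → refl ; 2F → refl }) refl refl (reachable-⟦⟧ (1F ∷ [ab]³))
    t₁₂ : Reachable (transpose 1F 2F , P.ε)
    t₁₂ = reachable-computed ⟦ 2F ∷ [ac]³ ⟧ (transpose 1F 2F , P.ε)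
        (λ { 0F → refl ; 1F → refl ; 2F → refl }) refl refl (reachable-⟦⟧ (2F ∷ [ac]³))

    rotated : ∀ k → Reachable (rotation k , P.ε)
    rotated 0F = reachable-⟦⟧ []
    rotated 1F = reachable-∘ₚ (transpose 0F 1F) (transpose 0F 2F) t₀₁ t₀₂
    rotated 2F = reachable-∘ₚ (transpose 0F 2F) (transpose 0F 1F) t₀₂ t₀₁

    flipped : ∀ s k → Reachable (permutation (s , k) , P.ε)
    flipped false k = rotated k
    flipped true  k = reachable-∘ₚ (transpose 1F 2F) (rotation k) t₁₂ (rotated k)

  reachable : ∀ g → Reachable g
  reachable g@(π , w) = reachable-resp {σ S₃×D.∙ (Perm.id , w)} {g}
    (permutation-surjective π , P.identityˡ w)
    (reachable-∙ {σ} {Perm.id , w} (reachable-permutation (odd π , π ⟨$⟩ʳ 0F)) (reachable-dihedral w))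
    where
    σ : V
    σ = permutation (odd π , π ⟨$⟩ʳ 0F) , P.ε

  connected : Connected (X n)
  connected = reachable⇒connected reachable

-- Girth and signature

-- A copy of `⟦_⟧` in which n does not occur, so that lists of trivial words evaluate to concrete
-- lists.
value : Word → Permutation′ 3 × Dih
value []      = Perm.id , Presentation.ε
value (s ∷ w) = colour s .proj₁ ∘ₚ value w .proj₁ , colour s .proj₂ Presentation.∙ value w .proj₂

-- For n = 0 this is triviality in the product of S₃ with the infinite dihedral
-- group.
Trivial : ℕ → Word → Set
Trivial n w = (∀ i → value w .proj₁ ⟨$⟩ʳ i ≡ i) × reflection (value w .proj₂) ≡ false ×
  n ∣ ℤ.∣ exponent (value w .proj₂) ∣

trivial? : ∀ n → Decidable (Trivial n)
trivial? n w = all? (λ i → value w .proj₁ ⟨$⟩ʳ i ≟ i) ×-dec (reflection (value w .proj₂) Bool.≟ false) ×-dec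
  (n ∣? ℤ.∣ exponent (value w .proj₂) ∣)

-- The implicit argument is the finite check of all nonempty reduced words of at most m letters;
-- evaluation supplies it.
reducedFrom-all : ∀ {P : Word → Set} (P? : Decidable P) m →
  {True (all? λ s → all? {m} λ k → All.all? P? (reducedFrom s (toℕ k)))} →
  ∀ s w → Reduced (s ∷ w) → length w < m → P (s ∷ w)
reducedFrom-all P? m {checked} s w red l<m = All.lookup (toWitness checked s (fromℕ< l<m))
  (subst (λ k → (s ∷ w) ∈ₗ reducedFrom s k) (≡.sym (toℕ-fromℕ< l<m)) (reducedFrom-complete s w red))

noShort₃ : ∀ s w → Reduced (s ∷ w) → length w < 5 → ¬ Trivial 3 (s ∷ w)
noShort₃ = reducedFrom-all (λ w → ¬? (trivial? 3 w)) 5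

noShort₀ : ∀ s w → Reduced (s ∷ w) → length w < 7 → ¬ Trivial 0 (s ∷ w)
noShort₀ = reducedFrom-all (λ w → ¬? (trivial? 0 w)) 7

trivialWords : ℕ → ℕ → Letter → List Word
trivialWords n m s = filter (trivial? n) (reducedFrom s m)

unique? : Decidable (Unique {A = Word})
unique? = allPairs? λ w x → ¬? (List.≡-dec _≟_ w x)

unique₃ : ∀ s → Unique (trivialWords 3 5 s)
unique₃ = toWitness {a? = all? λ s → unique? (trivialWords 3 5 s)} _

unique₀ : ∀ s → Unique (trivialWords 0 7 s)
unique₀ = toWitness {a? = all? λ s → unique? (trivialWords 0 7 s)} _

-- Found by enumeration, and sharp: the word bcbcbc has exponent 3. This is why the uniform
-- treatment starts at n = 4.
exponent-bound : ∀ s w → Reduced (s ∷ w) → length w < 8 →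
  (∀ i → value (s ∷ w) .proj₁ ⟨$⟩ʳ i ≡ i) → reflection (value (s ∷ w) .proj₂) ≡ false →
  ℤ.∣ exponent (value (s ∷ w) .proj₂) ∣ < 4
exponent-bound = reducedFrom-all (λ w →
  all? (λ i → value w .proj₁ ⟨$⟩ʳ i ≟ i) →-dec (reflection (value w .proj₂) Bool.≟ false) →-dec
  (ℤ.∣ exponent (value w .proj₂) ∣ <? 4)) 8

trivial-short⇔ : ∀ {n} → 4 ≤ n → ∀ w → Reduced w → length w ≤ 8 → Trivial n w ⇔ Trivial 0 w
trivial-short⇔ {n} 4≤n []      red _   = mk⇔ (λ (p , q , _) → p , q , 0 ∣0) (λ (p , q , _) → p , q , n ∣0)
trivial-short⇔ {n} 4≤n (s ∷ w) red l≤8 = mk⇔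
  (λ (p , q , d) → p , q , subst (0 ∣_) (≡.sym (vanishes (exponent-bound s w red l≤8 p q) d)) (0 ∣0))
  (λ (p , q , d) → p , q , subst (n ∣_) (≡.sym (0∣⇒≡0 d)) (n ∣0))
  where
  vanishes : ∀ {e} → e < 4 → n ∣ e → e ≡ 0
  vanishes {zero}  _   _ = refl
  vanishes {suc e} e<4 d = contradiction (∣⇒≤ d) (<⇒≱ (<-≤-trans e<4 4≤n))

module Girth (n′ : ℕ) where
  open CayleyGraph n′

  ⟦⟧≡value : ∀ w → ⟦ w ⟧ ≡ value w
  ⟦⟧≡value []      = refl
  ⟦⟧≡value (s ∷ w) = cong (λ (π , x) → colour s .proj₁ ∘ₚ π , colour s .proj₂ Presentation.∙ x) (⟦⟧≡value w)

  trivial⇔ : ∀ w → ⟦ w ⟧ ≈ Group.ε (S₃×D n) ⇔ Trivial n w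
  trivial⇔ w rewrite ⟦⟧≡value w = mk⇔
    (λ (p , q) → p , reflection-cong q , ∣⇒∣ᵤ (subst (ℤ.+ n ∣ℤ_) (ℤ.+-identityʳ e) (exponent-cong q)))
    (λ (p , q , d) → byCoordinates (value w) (Group.ε (S₃×D n)) p q
      (subst (ℤ.+ n ∣ℤ_) (≡.sym (ℤ.+-identityʳ e)) (∣ᵤ⇒∣ d)))
    where
    e : ℤ
    e = exponent (value w .proj₂)

  walk-closed⇔trivial : ∀ x w → walk x w ≈ x ⇔ Trivial n w
  walk-closed⇔trivial x w = ⇔.trans (walk-closed⇔ x w) (trivial⇔ w)

  -- The modulus l used for the enumeration may differ from n: it is 3 for `X 3` and 0 for all n ≥
  -- 4.
  module _ (m : ℕ) (3≤g : 3 ≤ suc m) (l : ℕ)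
    (closed⇔ : ∀ {w} → Reduced w → length w ≤ suc m → ∀ x → walk x w ≈ x ⇔ Trivial l w)
    (noShort : ∀ s w → Reduced (s ∷ w) → length w < m → ¬ Trivial l (s ∷ w))
    (unique : ∀ s → Unique (trivialWords l m s))
    {s₀ : Letter} {w₀ : Word} (w₀∈ : w₀ ∈ₗ trivialWords l m s₀)
    where
    open Circuits m 3≤g (Trivial l) (trivial? l) closed⇔ noShort

    hasGirth : HasGirth (X n) (suc m)
    hasGirth = girth unique (Group.ε (S₃×D n)) w₀∈

    edgeCount : ∀ x s → GirthCycleCount (X n) x (x · s) (length (trivialWords l m s))
    edgeCount x s = suc m , hasGirth , cyclesThrough-cardinality unique x s

    hasSignature : (σ : Permutation′ 3) →
      (let ϵ = λ i → length (trivialWords l m (σ ⟨$⟩ʳ i))) →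
      ϵ 0F ≤ ϵ 1F → ϵ 1F ≤ ϵ 2F → HasSignature (X n) (ϵ 0F , ϵ 1F , ϵ 2F)
    hasSignature σ p q x = p , q , neighbours σ x ,
      edgeCount x (σ ⟨$⟩ʳ 0F) , edgeCount x (σ ⟨$⟩ʳ 1F) , edgeCount x (σ ⟨$⟩ʳ 2F)

girth₃ : HasGirth (X 3) 6
girth₃ = Girth.hasGirth 2 5 (s≤s (s≤s (s≤s z≤n))) 3
  -- The witness begins with b because no 6-cycle contains an a-edge; it is the word bcbcbc.
  (λ {w} _ _ x → Girth.walk-closed⇔trivial 2 x w) noShort₃ unique₃ {1F} (here refl)

signature₃ : HasSignature (X 3) (0 , 1 , 1)
signature₃ = Girth.hasSignature 2 5 (s≤s (s≤s (s≤s z≤n))) 3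
  (λ {w} _ _ x → Girth.walk-closed⇔trivial 2 x w) noShort₃ unique₃ {1F} (here refl) Perm.id z≤n (s≤s z≤n)

module Girth8 (n′ : ℕ) (4≤n : 4 ≤ suc n′) where
  open CayleyGraph n′
  open Girth n′

  closed⇔ : ∀ {w} → Reduced w → length w ≤ 8 → ∀ x → walk x w ≈ x ⇔ Trivial 0 w
  closed⇔ {w} red l≤8 x = ⇔.trans (walk-closed⇔trivial x w) (trivial-short⇔ 4≤n w red l≤8)

  girth₈ : HasGirth (X n) 8
  girth₈ = hasGirth 7 (s≤s (s≤s (s≤s z≤n))) 0 closed⇔ noShort₀ unique₀ {0F} (here refl)

  edgeCount₈ : ∀ x s → GirthCycleCount (X n) x (x · s) (length (trivialWords 0 7 s))
  edgeCount₈ = edgeCount 7 (s≤s (s≤s (s≤s z≤n))) 0 closed⇔ noShort₀ unique₀ {0F} (here refl)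

  signature₈ : HasSignature (X n) (5 , 5 , 6)
  signature₈ = hasSignature 7 (s≤s (s≤s (s≤s z≤n))) 0 closed⇔ noShort₀ unique₀ {0F} (here refl)
    -- The counts for a, b, c are 6, 5, 5, so the neighbours are listed in the order b, c, a.
    (transpose 0F 1F ∘ₚ transpose 0F 2F) ℕ.≤-refl (ℕ.n≤1+n 5)

-- 3-rainbow domination

sum-mono-≤ : ∀ {m} {f g : Fin m → ℕ} → (∀ i → f i ≤ g i) → sum f ≤ sum g
sum-mono-≤ {zero}  f≤g = z≤n
sum-mono-≤ {suc m} f≤g = +-mono-≤ (f≤g zero) (sum-mono-≤ (λ i → f≤g (suc i)))

sum-const : ∀ m k → sum {m} (λ _ → k) ≡ m * k
sum-const zero    k = refl
sum-const (suc m) k = cong (k +_) (sum-const m k)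

∣p∪q∣≤∣p∣+∣q∣ : ∀ {n} (p q : Subset n) → ∣ p Subset.∪ q ∣ ≤ ∣ p ∣ + ∣ q ∣
∣p∪q∣≤∣p∣+∣q∣ []            []            = z≤n
∣p∪q∣≤∣p∣+∣q∣ (outside ∷ p) (outside ∷ q) = ∣p∪q∣≤∣p∣+∣q∣ p q
∣p∪q∣≤∣p∣+∣q∣ (outside ∷ p) (inside  ∷ q) =
  ≤-trans (s≤s (∣p∪q∣≤∣p∣+∣q∣ p q)) (ℕ.≤-reflexive (≡.sym (ℕ.+-suc ∣ p ∣ ∣ q ∣)))
∣p∪q∣≤∣p∣+∣q∣ (inside  ∷ p) (outside ∷ q) = s≤s (∣p∪q∣≤∣p∣+∣q∣ p q)
∣p∪q∣≤∣p∣+∣q∣ (inside  ∷ p) (inside  ∷ q) =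
  s≤s (≤-trans (∣p∪q∣≤∣p∣+∣q∣ p q) (ℕ.+-monoʳ-≤ ∣ p ∣ (ℕ.n≤1+n ∣ q ∣)))

∈⇒1≤∣p∣ : ∀ {n} {p : Subset n} {i} → i ∈ p → 1 ≤ ∣ p ∣
∈⇒1≤∣p∣ {p = p} {i} i∈p = subst (_≤ ∣ p ∣) (∣⁅x⁆∣≡1 i)
  (p⊆q⇒∣p∣≤∣q∣ λ j∈ → subst (_∈ p) (≡.sym (x∈⁅y⁆⇒x≡y i j∈)) i∈p)

module _ (G : Graph) where

  open Graph G

  module Domination
    (_·_ : V → Letter → V)
    (·-cong : ∀ {x y} s → x ≈ y → (x · s) ≈ (y · s))
    (·-involutive : ∀ x s → ((x · s) · s) ≈ x)
    (~⇒· : ∀ {x y} → x ~ y → ∃ λ s → y ≈ (x · s))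
    {m} (enum : HasOrder G m)
    where

    open Inverse enum
    open Setoid vertices using (sym; trans)

    -- Each colour class is a perfect matching, so moving along it permutes the vertices and leaves
    -- sums over them unchanged.
    shift : Letter → Permutation′ m
    shift s = Perm.permutation move move move-move move-move
      where
      move : Fin m → Fin m
      move i = from (to i · s)

      move-move : ∀ i → move (move i) ≡ i
      move-move i = ≡.trans
        (from-cong (trans (·-cong s (strictlyInverseˡ (to i · s))) (·-involutive (to i) s)))
        (strictlyInverseʳ i)

    sum-shift : ∀ (h : V → ℕ) → (∀ {x y} → x ≈ y → h x ≡ h y) → ∀ s →
                sum (λ i → h (to i · s)) ≡ sum (λ i → h (to i))
    sum-shift h h-cong s = ≡.trans
      (sum-cong-≗ (λ i → h-cong (sym (strictlyInverseˡ (to i · s)))))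
      (≡.sym (sum-permute (λ i → h (to i)) (shift s)))

    module _ (F : RDF G) where
      open RDF F

      size : V → ℕ
      size x = ∣ f x ∣

      size-cong : ∀ {x y} → x ≈ y → size x ≡ size y
      size-cong p = cong ∣_∣ (f-cong p)

      W : ℕ
      W = weight G enum F

      sum-shifted : ∀ s → sum (λ i → size (to i) + size (to i · s)) ≡ W + W
      sum-shifted s = ≡.trans (∑-distrib-+ (λ i → size (to i)) (λ i → size (to i · s)))
        (cong (W +_) (sum-shift size size-cong s))

      -- A nonempty set at x contributes to all three brackets; an empty one forces three colours
      -- onto the neighbours. Grouping by edges lets `sum-shifted` evaluate the total colour by
      -- colour.
      local : ∀ x → 3 ≤ (size x + size (x · 0F)) + ((size x + size (x · 1F)) + (size x + size (x · 2F)))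
      local x with nonempty? (f x)
      ... | yes (i , i∈) = +-mono-≤ (weaken (x · 0F)) (+-mono-≤ (weaken (x · 1F)) (weaken (x · 2F)))
        where
        weaken : ∀ y → 1 ≤ size x + size y
        weaken y = ≤-trans (∈⇒1≤∣p∣ i∈) (m≤m+n (size x) (size y))
      ... | no empty = ≤-trans
        (p⊆q⇒∣p∣≤∣q∣ {p = Subset.⊤} {f (x · 0F) Subset.∪ (f (x · 1F) Subset.∪ f (x · 2F))} λ {c} _ → covered c)
        (≤-trans (∣p∪q∣≤∣p∣+∣q∣ (f (x · 0F)) _)
          (+-mono-≤ (ℕ.m≤n+m (size (x · 0F)) (size x)) (≤-trans (∣p∪q∣≤∣p∣+∣q∣ (f (x · 1F)) (f (x · 2F)))
            (+-mono-≤ (ℕ.m≤n+m (size (x · 1F)) (size x)) (ℕ.m≤n+m (size (x · 2F)) (size x))))))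
        where
        covered : ∀ c → c ∈ f (x · 0F) Subset.∪ (f (x · 1F) Subset.∪ f (x · 2F))
        covered c with dominating x (Empty-unique empty) c
        ... | y , x~y , c∈ with ~⇒· x~y
        ... | 0F , y≈ = x∈p∪q⁺ (inj₁ (subst (c ∈_) (f-cong y≈) c∈))
        ... | 1F , y≈ = x∈p∪q⁺ (inj₂ (x∈p∪q⁺ (inj₁ (subst (c ∈_) (f-cong y≈) c∈))))
        ... | 2F , y≈ = x∈p∪q⁺ (inj₂ (x∈p∪q⁺ (inj₂ (subst (c ∈_) (f-cong y≈) c∈))))

      -- Three times the weight of a vertex plus the weights of its neighbours is at
      -- least 3; sum this over all vertices.
      order≤2*weight : m ≤ 2 * W
      order≤2*weight = *-cancelˡ-≤ 3 (subst (_≤ 3 * (2 * W)) (ℕ.*-comm m 3) (≤-trans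
        (≤-trans (ℕ.≤-reflexive (≡.sym (sum-const m 3))) (sum-mono-≤ (λ i → local (to i))))
        (ℕ.≤-reflexive (≡.trans
          (∑-distrib-+ (λ i → size (to i) + size (to i · 0F)) _)
          (≡.trans (cong₂ _+_ (sum-shifted 0F) (≡.trans
              (∑-distrib-+ (λ i → size (to i) + size (to i · 1F)) (λ i → size (to i) + size (to i · 2F)))
              (cong₂ _+_ (sum-shifted 1F) (sum-shifted 2F))))
            (arith W))))))
        where
        arith : ∀ W → (W + W) + ((W + W) + (W + W)) ≡ 3 * (2 * W)
        arith = solve-∀

      balanced⇒2*weight : ∀ s → (∀ x → size x + size (x · s) ≡ 1) → 2 * W ≡ m
      balanced⇒2*weight s balanced = ≡.trans (cong (W +_) (ℕ.+-identityʳ W))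
        (≡.trans (≡.sym (sum-shifted s)) (≡.trans (sum-cong-≗ (λ i → balanced (to i)))
          (≡.trans (sum-const m 1) (ℕ.*-identityʳ m))))

-- Transpositions change the sign. Only the images of 0 and 1 enter `odd`, so a finite table over
-- pairs of distinct points decides it.
odd-∘ₚ-colour : ∀ π s → odd (π ∘ₚ colour s .proj₁) ≡ not (odd π)
odd-∘ₚ-colour π s = table s (π ⟨$⟩ʳ 0F) (π ⟨$⟩ʳ 1F) (λ p → contradiction (⟨$⟩ʳ-injective π p) λ ())
  where
  table : ∀ s i j → i ≢ j → oddPair (colour s .proj₁ ⟨$⟩ʳ i) (colour s .proj₁ ⟨$⟩ʳ j) ≡ not (oddPair i j)
  table = from-yes (all? {3} λ s → all? {3} λ i → all? {3} λ j → ¬? (i ≟ j) →-dec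
    (oddPair (colour s .proj₁ ⟨$⟩ʳ i) (colour s .proj₁ ⟨$⟩ʳ j) Bool.≟ not (oddPair i j)))

module RainbowDomination (n′ : ℕ) where
  open CayleyGraph n′
  open Domination (X n) _·_ (λ {x} {y} → ·-cong {x} {y}) ·-involutive (λ {x} {y} → ~⇒· {x} {y}) hasOrder

  preimageOf0 : Permutation′ 3 → Subset 3
  preimageOf0 π = if odd π then ∅ else ⁅ π ⟨$⟩ˡ 0F ⁆

  -- The neighbours of an odd vertex π send three different points to 0.
  rainbow : RDF (X n)
  rainbow = record
    { f          = λ x → preimageOf0 (x .proj₁)
    ; f-cong     = λ {x} {y} p → f-cong (x .proj₁) (y .proj₁) (p .proj₁)
    ; dominating = λ x p c → dominating (x .proj₁) (x .proj₂) p c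
    }
    where
    f-cong : ∀ π σ → π Perm.≈ σ → preimageOf0 π ≡ preimageOf0 σ
    f-cong π σ p = cong₂ (λ s i → if s then ∅ else ⁅ i ⁆) (cong₂ oddPair (p 0F) (p 1F))
      (Group.⁻¹-cong (symmetricGroup 3) {π} {σ} p 0F)

    letter : ∀ (i : Fin 3) → ∃ λ s → colour s .proj₁ ⟨$⟩ˡ 0F ≡ i
    letter 0F = 2F , refl
    letter 1F = 0F , refl
    letter 2F = 1F , refl

    dominating : ∀ π w → preimageOf0 π ≡ ∅ → ∀ c → ∃ λ y → ((π , w) ~ y) × c ∈ preimageOf0 (y .proj₁)
    dominating π w p c with odd π in eq
    ... | false = contradiction (subst (π ⟨$⟩ˡ 0F ∈_) p (x∈⁅x⁆ (π ⟨$⟩ˡ 0F))) ∉⊥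
    -- The letter is chosen so that its transposition exchanges 0 and π(c), or fixes 0 if they
    -- agree; the neighbour then sends c to 0.
    ... | true with letter (π ⟨$⟩ʳ c)
    ... | s , q = (π , w) · s , ~-colour (π , w) s ,
      subst (c ∈_) (≡.sym (cong (λ b → if b then ∅ else ⁅ π ⟨$⟩ˡ (colour s .proj₁ ⟨$⟩ˡ 0F) ⁆)
          (≡.trans (odd-∘ₚ-colour π s) (cong not eq))))
        (subst (λ i → c ∈ ⁅ i ⁆) (≡.sym (≡.trans (cong (π ⟨$⟩ˡ_) q) (Perm.inverseˡ π))) (x∈⁅x⁆ c))

  -- An a-edge joins an even vertex, of weight one, to an odd vertex, of weight zero; this gives
  -- half the order as total weight.
  balanced : ∀ x → ∣ preimageOf0 (x .proj₁) ∣ + ∣ preimageOf0 ((x · 0F) .proj₁) ∣ ≡ 1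
  balanced (π , w) rewrite odd-∘ₚ-colour π 0F with odd π
  ... | false = cong (_+ 0) (∣⁅x⁆∣≡1 (π ⟨$⟩ˡ 0F))
  ... | true  = ∣⁅x⁆∣≡1 (π ⟨$⟩ˡ 1F)

  is3RDR : Is3RDR (X n)
  is3RDR = cubic , 12 * n , weight (X n) hasOrder rainbow , hasOrder ,
    ((rainbow , refl) , λ F → *-cancelˡ-≤ 2 (ℕ.≤-trans (ℕ.≤-reflexive 2*W) (order≤2*weight F))) , 2*W
    where
    2*W : 2 * weight (X n) hasOrder rainbow ≡ 12 * n
    2*W = balanced⇒2*weight rainbow 0F balanced

-- n not divisible by 3

3∤n∧3∣l∧n∣l⇒3n∣l : ∀ {n l} → ¬ 3 ∣ n → 3 ∣ l → n ∣ l → 3 * n ∣ l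
3∤n∧3∣l∧n∣l⇒3n∣l {n} 3∤n 3∣l (ℕ∣.divides j refl) with euclidsLemma j n (from-yes (prime? 3)) 3∣l
... | inj₁ 3∣j = ℕ∣.*-monoˡ-∣ n 3∣j
... | inj₂ 3∣n = contradiction 3∣n 3∤n

module GeneralizedPetersen (n′ : ℕ) where
  open CayleyGraph n′
  private module S₃×D = Group (S₃×D n)

  perm : ℕ → Fin 3 → Fin 3
  perm i j = path i .proj₁ ⟨$⟩ʳ j

  -- On points bc is a 3-cycle, so six steps of the path act trivially; at each concrete point this
  -- is an evaluation.
  perm-period : ∀ q i j → perm (q * 6 + i) j ≡ perm i j
  perm-period zero    i j  = refl
  perm-period (suc q) i 0F = perm-period q i 0F
  perm-period (suc q) i 1F = perm-period q i 1F
  perm-period (suc q) i 2F = perm-period q i 2F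

  reflection-even : ∀ l → reflection (path (l * 2) .proj₂) ≡ false
  reflection-even zero    = refl
  reflection-even (suc l) = reflection-even l

  reflection-odd : ∀ l → reflection (path (1 + l * 2) .proj₂) ≡ true
  reflection-odd zero    = refl
  reflection-odd (suc l) = reflection-odd l

  exponent-even : ∀ l → exponent (path (l * 2) .proj₂) ≡ ℤ.+ l
  exponent-even zero    = refl
  exponent-even (suc l) = cong (ℤ._+_ (ℤ.+ 1)) (exponent-even l)

  exponent-odd : ∀ l → exponent (path (1 + l * 2) .proj₂) ≡ ℤ.+ l
  exponent-odd zero    = refl
  exponent-odd (suc l) = cong (ℤ._+_ (ℤ.+ 1)) (exponent-odd l)

  multiple≡0 : ∀ {j} q → j ≡ q * n → ℤ.+ j ≡ ℤ.+ 0 [mod n ]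
  multiple≡0 {j} q p = ℤ.divides (ℤ.+ q) (≡.trans (ℤ.+-identityʳ (ℤ.+ j)) (≡.trans (cong ℤ.+_ p) (ℤ.pos-* q n)))

  ≡0⇒∣ : ∀ l → ℤ.+ l ≡ ℤ.+ 0 [mod n ] → n ∣ l
  ≡0⇒∣ l p = subst (n ∣_) (cong ℤ.∣_∣ (ℤ.+-identityʳ (ℤ.+ l))) (∣⇒∣ᵤ p)

  Mod3 : ℕ → Set
  Mod3 l = ∃ λ (ρ : Fin 3) → (∀ j → perm (l * 2) j ≡ perm (toℕ ρ * 2) j) ×
    (∀ j → perm (1 + l * 2) j ≡ perm (1 + toℕ ρ * 2) j) × (ρ ≡ 0F → 3 ∣ l)

  mod3 : ∀ l → Mod3 l
  mod3 l with l divMod 3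
  ... | result q ρ refl = ρ ,
    (λ j → ≡.trans (cong (λ i → perm i j) (even (toℕ ρ) q)) (perm-period q (toℕ ρ * 2) j)) ,
    (λ j → ≡.trans (cong (λ i → perm i j) (odd′ (toℕ ρ) q)) (perm-period q (1 + toℕ ρ * 2) j)) ,
    λ { refl → n∣m*n q }
    where
    even : ∀ ρ q → (ρ + q * 3) * 2 ≡ q * 6 + ρ * 2
    even = solve-∀
    odd′ : ∀ ρ q → 1 + (ρ + q * 3) * 2 ≡ q * 6 + (1 + ρ * 2)
    odd′ = solve-∀

  perm-even-id : ∀ l → Mod3 l → (∀ j → perm (l * 2) j ≡ j) → 3 ∣ l
  perm-even-id l (0F , _ , _ , 3∣l) p = 3∣l refl
  perm-even-id l (1F , q , _) p = contradiction (≡.trans (≡.sym (q 0F)) (p 0F)) λ ()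
  perm-even-id l (2F , q , _) p = contradiction (≡.trans (≡.sym (q 0F)) (p 0F)) λ ()

  perm-odd-b : ∀ l → Mod3 l → (∀ j → perm (1 + l * 2) j ≡ perm 1 j) → 3 ∣ l
  perm-odd-b l (0F , _ , _ , 3∣l) p = 3∣l refl
  perm-odd-b l (1F , _ , q , _) p = contradiction (≡.trans (≡.sym (q 0F)) (p 0F)) λ ()
  perm-odd-b l (2F , _ , q , _) p = contradiction (≡.trans (≡.sym (q 0F)) (p 0F)) λ ()

  perm-even-a : ∀ l → Mod3 l → ¬ (∀ j → perm (l * 2) j ≡ colour 0F .proj₁ ⟨$⟩ʳ j)
  perm-even-a l (0F , q , _) p = contradiction (≡.trans (≡.sym (q 0F)) (p 0F)) λ ()
  perm-even-a l (1F , q , _) p = contradiction (≡.trans (≡.sym (q 2F)) (p 2F)) λ ()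
  perm-even-a l (2F , q , _) p = contradiction (≡.trans (≡.sym (q 2F)) (p 2F)) λ ()

  perm-odd-ba : ∀ l → Mod3 l → ¬ (∀ j → perm (1 + l * 2) j ≡ colour 0F .proj₁ ⟨$⟩ʳ perm 1 j)
  perm-odd-ba l (0F , _ , q , _) p = contradiction (≡.trans (≡.sym (q 2F)) (p 2F)) λ ()
  perm-odd-ba l (1F , _ , q , _) p = contradiction (≡.trans (≡.sym (q 0F)) (p 0F)) λ ()
  perm-odd-ba l (2F , _ , q , _) p = contradiction (≡.trans (≡.sym (q 0F)) (p 0F)) λ ()

  parity : ∀ d → (∃ λ l → d ≡ l * 2) ⊎ (∃ λ l → d ≡ 1 + l * 2)
  parity d with d divMod 2
  ... | result l 0F eq = inj₁ (l , eq)
  ... | result l 1F eq = inj₂ (l , eq)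

  evenReflection : ∀ l x → path (l * 2) ≈ x → false ≡ reflection (x .proj₂)
  evenReflection l x p = ≡.trans (≡.sym (reflection-even l)) (reflection-cong (p .proj₂))

  oddReflection : ∀ l x → path (1 + l * 2) ≈ x → true ≡ reflection (x .proj₂)
  oddReflection l x p = ≡.trans (≡.sym (reflection-odd l)) (reflection-cong (p .proj₂))

  module _ (3∤n : ¬ 3 ∣ n) where

    6n∣2l : ∀ l → 3 ∣ l → n ∣ l → 6 * n ∣ l * 2
    6n∣2l l 3∣l n∣l = subst (_∣ l * 2) (arith n) (ℕ∣.*-monoˡ-∣ 2 (3∤n∧3∣l∧n∣l⇒3n∣l 3∤n 3∣l n∣l))
      where
      arith : ∀ n → 3 * n * 2 ≡ 6 * n
      arith = solve-∀

    -- The reflection coordinate forces d = 2l. The permutation then gives 3 ∣ l and the exponent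
    -- gives n ∣ l; since 3 does not divide n, both combine to 3n ∣ l.
    return₀ : ∀ d → path d ≈ (path 0 S₃×D.∙ S₃×D.ε) → 6 * n ∣ d
    return₀ d = go (parity d)
      where
      go : (∃ λ l → d ≡ l * 2) ⊎ (∃ λ l → d ≡ 1 + l * 2) → path d ≈ (path 0 S₃×D.∙ S₃×D.ε) → 6 * n ∣ d
      go (inj₁ (l , refl)) p = 6n∣2l l (perm-even-id l (mod3 l) (p .proj₁))
        (≡0⇒∣ l (subst (_≡ ℤ.+ 0 [mod n ]) (exponent-even l)
          (exponent-cong {w = path (l * 2) .proj₂} {Presentation.ε Presentation.∙ Presentation.ε} (p .proj₂))))
      go (inj₂ (l , refl)) p = contradiction (oddReflection l (path 0 S₃×D.∙ S₃×D.ε) p) λ ()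

    return₁ : ∀ d → path (suc d) ≈ (path 1 S₃×D.∙ S₃×D.ε) → 6 * n ∣ d
    return₁ d = go (parity d)
      where
      go : (∃ λ l → d ≡ l * 2) ⊎ (∃ λ l → d ≡ 1 + l * 2) → path (suc d) ≈ (path 1 S₃×D.∙ S₃×D.ε) → 6 * n ∣ d
      go (inj₁ (l , refl)) p = 6n∣2l l (perm-odd-b l (mod3 l) (p .proj₁))
        (≡0⇒∣ l (subst (_≡ ℤ.+ 0 [mod n ]) (exponent-odd l)
          (exponent-cong {w = path (1 + l * 2) .proj₂} {z Presentation.∙ Presentation.ε} (p .proj₂))))
      go (inj₂ (l , refl)) p = contradiction (evenReflection (suc l) (path 1 S₃×D.∙ S₃×D.ε) p) λ ()

  -- Each of b and c changes both the sign of the permutation and the reflection coordinate, whereas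
  -- a changes only the sign. Along the path the two stay in step, so no path vertex is an
  -- a-neighbour of another.
  apart₀ : ∀ d → ¬ path d ≈ (path 0 · 0F)
  apart₀ d = go (parity d)
    where
    go : (∃ λ l → d ≡ l * 2) ⊎ (∃ λ l → d ≡ 1 + l * 2) → ¬ path d ≈ (path 0 · 0F)
    go (inj₁ (l , refl)) p = perm-even-a l (mod3 l) (p .proj₁)
    go (inj₂ (l , refl)) p = contradiction (oddReflection l (path 0 · 0F) p) λ ()

  apart₁ : ∀ d → ¬ path (suc d) ≈ (path 1 · 0F)
  apart₁ d = go (parity d)
    where
    go : (∃ λ l → d ≡ l * 2) ⊎ (∃ λ l → d ≡ 1 + l * 2) → ¬ path (suc d) ≈ (path 1 · 0F)
    go (inj₁ (l , refl)) p = perm-odd-ba l (mod3 l) (p .proj₁)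
    go (inj₂ (l , refl)) p = contradiction (evenReflection (suc l) (path 1 · 0F) p) λ ()

  6n≡ : ∀ n → 6 * n ≡ (n * 3) * 2
  6n≡ = solve-∀

  period₀ : path (6 * n) ≈ path 0
  period₀ = subst (λ m → path m ≈ path 0) (≡.sym (6n≡ n)) (byCoordinates (path ((n * 3) * 2)) (path 0)
    (λ j → ≡.trans (cong (λ i → perm i j) (arith n)) (perm-period n 0 j))
    (reflection-even (n * 3))
    (subst (_≡ ℤ.+ 0 [mod n ]) (≡.sym (exponent-even (n * 3))) (multiple≡0 3 (ℕ.*-comm n 3))))
    where
    arith : ∀ n → (n * 3) * 2 ≡ n * 6 + 0
    arith = solve-∀

  period₁ : path (suc (6 * n)) ≈ path 1
  period₁ = subst (λ m → path (suc m) ≈ path 1) (≡.sym (6n≡ n)) (byCoordinates (path (1 + (n * 3) * 2)) (path 1)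
    (λ j → ≡.trans (cong (λ i → perm i j) (arith n)) (perm-period n 1 j))
    (reflection-odd (n * 3))
    (subst (_≡ ℤ.+ 0 [mod n ]) (≡.sym (exponent-odd (n * 3))) (multiple≡0 3 (ℕ.*-comm n 3))))
    where
    arith : ∀ n → 1 + (n * 3) * 2 ≡ n * 6 + 1
    arith = solve-∀

  order : HasCardinality (Graph.vertices (X n)) (6 * n + 6 * n)
  order = subst (HasCardinality (Graph.vertices (X n))) (arith n) hasOrder
    where
    arith : ∀ n → 12 * n ≡ 6 * n + 6 * n
    arith = solve-∀

  module _ (3∤n : ¬ 3 ∣ n) (k : ℕ) (1≤k : 1 ≤ k) (2k<m : 2 * k < 6 * n) (s t : Letter)
    (chord₀ : (path k · 0F · s) ≈ (path 0 · 0F)) (chord₁ : (path (suc k) · 0F · t) ≈ (path 1 · 0F)) where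

    X≅GP : ∃₂ λ p q → X n ≅ GP (6 * n) k p q
    X≅GP = 1≤k , ℕ.<⇒≤ 2k<m , graph≅GP 1≤k (ℕ.<⇒≤ 2k<m)
      where
      open Petersen (6 * n) k 1≤k 2k<m period₀ period₁ s t chord₀ chord₁
        (return₀ 3∤n) (return₁ 3∤n) apart₀ apart₁ order

module _ (q : ℕ) where

  -- The chord length 2n - 1 comes from aca = (bc)ⁿ⁻¹b: both have dihedral part zr, and the
  -- permutations agree because 3 divides n - 1. The letters c and b are thus the first two inner
  -- steps.
  X≅GP-1mod3 : let n = 1 + q * 3 in ¬ 3 ∣ n → ∃₂ λ p q → X n ≅ GP (6 * n) (2 * n ∸ 1) p q
  X≅GP-1mod3 3∤n = subst (λ k → ∃₂ λ p q → X n ≅ GP (6 * n) k p q) (≡.sym (k≡ n′))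
    (X≅GP 3∤n (1 + n′ * 2) (s≤s z≤n) 2k<m 2F 1F
      (byCoordinates (path (1 + n′ * 2) · 0F · 2F) (path 0 · 0F)
        (λ { 0F → cong f (period 1 0F) ; 1F → cong f (period 1 1F) ; 2F → cong f (period 1 2F) })
        r₀ e₀)
      (byCoordinates (path (n * 2) · 0F · 1F) (path 1 · 0F)
        (λ { 0F → cong g (period 2 0F) ; 1F → cong g (period 2 1F) ; 2F → cong g (period 2 2F) })
        r₁ e₁))
    where
    n′ : ℕ
    n′ = q * 3
    open CayleyGraph n′
    open GeneralizedPetersen n′

    f g : Fin 3 → Fin 3
    f i = colour 2F .proj₁ ⟨$⟩ʳ (colour 0F .proj₁ ⟨$⟩ʳ i)
    g i = colour 1F .proj₁ ⟨$⟩ʳ (colour 0F .proj₁ ⟨$⟩ʳ i)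

    k≡ : ∀ n′ → 2 * suc n′ ∸ 1 ≡ 1 + n′ * 2
    k≡ n′ = cong (_∸ 1) (arith n′)
      where
      arith : ∀ n′ → 2 * suc n′ ≡ 2 + n′ * 2
      arith = solve-∀

    2k<m : 2 * (1 + n′ * 2) < 6 * n
    2k<m = subst (2 * (1 + n′ * 2) <_) (≡.sym (arith n′)) (m<m+n (2 * (1 + n′ * 2)) (s≤s z≤n))
      where
      arith : ∀ n′ → 6 * suc n′ ≡ 2 * (1 + n′ * 2) + suc (3 + 2 * n′)
      arith = solve-∀

    period : ∀ i j → perm (i + q * 3 * 2) j ≡ perm i j
    period i j = ≡.trans (cong (λ l → perm l j) (arith i q)) (perm-period q i j)
      where
      arith : ∀ i q → i + q * 3 * 2 ≡ q * 6 + i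
      arith = solve-∀

    r₀ : reflection ((path (1 + n′ * 2) · 0F · 2F) .proj₂) ≡ false
    r₀ rewrite reflection-odd n′ = refl

    e₀ : exponent ((path (1 + n′ * 2) · 0F · 2F) .proj₂) ≡ ℤ.+ 0 [mod n ]
    e₀ rewrite reflection-odd n′ | exponent-odd n′ = multiple≡0 1 (arith n′)
      where
      arith : ∀ n′ → n′ + 0 + 1 ≡ 1 * suc n′
      arith = solve-∀

    r₁ : reflection ((path (n * 2) · 0F · 1F) .proj₂) ≡ true
    r₁ rewrite reflection-even n = refl

    e₁ : exponent ((path (n * 2) · 0F · 1F) .proj₂) ≡ ℤ.+ 0 [mod n ]
    e₁ rewrite reflection-even n | exponent-even n = multiple≡0 1 (arith n)
      where
      arith : ∀ n → n + 0 + 0 ≡ 1 * n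
      arith = solve-∀

  -- Here aba = (bc)ⁿb gives the chord length 2n + 1: rⁿ vanishes, and for n ≡ 2 the path
  -- permutation at 2n + 1 is that at position 5, namely that of c. The inner letters b and c have
  -- exchanged roles.
  X≅GP-2mod3 : let n = 2 + q * 3 in ¬ 3 ∣ n → ∃₂ λ p q → X n ≅ GP (6 * n) (2 * n + 1) p q
  X≅GP-2mod3 3∤n = subst (λ k → ∃₂ λ p q → X n ≅ GP (6 * n) k p q) (≡.sym (k≡ n))
    (X≅GP 3∤n (1 + n * 2) (s≤s z≤n) 2k<m 1F 2F
      (byCoordinates (path (1 + n * 2) · 0F · 1F) (path 0 · 0F)
        (λ { 0F → cong f (period 5 0F) ; 1F → cong f (period 5 1F) ; 2F → cong f (period 5 2F) })
        r₀ e₀)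
      (byCoordinates (path (suc n * 2) · 0F · 2F) (path 1 · 0F)
        (λ { 0F → cong g (period 6 0F) ; 1F → cong g (period 6 1F) ; 2F → cong g (period 6 2F) })
        r₁ e₁))
    where
    n′ : ℕ
    n′ = 1 + q * 3
    open CayleyGraph n′
    open GeneralizedPetersen n′

    f g : Fin 3 → Fin 3
    f i = colour 1F .proj₁ ⟨$⟩ʳ (colour 0F .proj₁ ⟨$⟩ʳ i)
    g i = colour 2F .proj₁ ⟨$⟩ʳ (colour 0F .proj₁ ⟨$⟩ʳ i)

    k≡ : ∀ n → 2 * n + 1 ≡ 1 + n * 2
    k≡ = solve-∀

    2k<m : 2 * (1 + n * 2) < 6 * n
    2k<m = subst (2 * (1 + n * 2) <_) (≡.sym (arith (q * 3))) (m<m+n (2 * (1 + n * 2)) (s≤s z≤n))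
      where
      arith : ∀ l → 6 * (2 + l) ≡ 2 * (1 + (2 + l) * 2) + suc (1 + 2 * l)
      arith = solve-∀

    period : ∀ i j → perm (i + q * 3 * 2) j ≡ perm i j
    period i j = ≡.trans (cong (λ l → perm l j) (arith i q)) (perm-period q i j)
      where
      arith : ∀ i q → i + q * 3 * 2 ≡ q * 6 + i
      arith = solve-∀

    r₀ : reflection ((path (1 + n * 2) · 0F · 1F) .proj₂) ≡ false
    r₀ rewrite reflection-odd n = refl

    e₀ : exponent ((path (1 + n * 2) · 0F · 1F) .proj₂) ≡ ℤ.+ 0 [mod n ]
    e₀ rewrite reflection-odd n | exponent-odd n = multiple≡0 1 (arith n)
      where
      arith : ∀ n → n + 0 + 0 ≡ 1 * n
      arith = solve-∀

    r₁ : reflection ((path (suc n * 2) · 0F · 2F) .proj₂) ≡ true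
    r₁ rewrite reflection-even (suc n) = refl

    e₁ : exponent ((path (suc n * 2) · 0F · 2F) .proj₂) ≡ ℤ.+ 0 [mod n ]
    e₁ rewrite reflection-even (suc n) | exponent-even (suc n) = multiple≡0 1 (arith n)
      where
      arith : ∀ n → n + 0 ≡ 1 * n
      arith = solve-∀

-- n divisible by 3

≅-trans : ∀ {G H K} → G ≅ H → H ≅ K → G ≅ K
≅-trans φ ψ = record
  { bijection = _≅_.bijection φ ∘-inverse _≅_.bijection ψ
  ; ~-iff     = λ x y → ⇔.trans (_≅_.~-iff φ x y) (_≅_.~-iff ψ (_≅_.to φ x) (_≅_.to φ y))
  }

-- An isomorphism injects the cycles through an edge into those through its image. The inequality
-- suffices, since it will be refuted in the form 6 ≤ 5.
cyclesThrough-≤ : ∀ {G H} (φ : G ≅ H) {ℓ x y x′ y′ j k} →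
  Graph._≈_ H (_≅_.to φ x) x′ → Graph._≈_ H (_≅_.to φ y) y′ →
  HasCardinality (cyclesThrough G ℓ x y) j → HasCardinality (cyclesThrough H ℓ x′ y′) k → j ≤ k
cyclesThrough-≤ {G} {H} φ {ℓ} {x} {y} {x′} {y′} p q J K =
  injection⇒≤ {cyclesThrough G ℓ x y} {cyclesThrough H ℓ x′ y′} J K
    (λ (C , e) → mapCycle C , Cycles.hasEdge-resp H (mapCycle C) p q (Equivalence.to (mapCycle-hasEdge C) e))
    (λ {(C , _)} {(C′ , _)} C≋C′ x y →
      ⇔.trans (mapCycle-hasEdge C) (⇔.trans (C≋C′ (_≅_.to φ x) (_≅_.to φ y)) (⇔.sym (mapCycle-hasEdge C′))))
  where open CycleMap φ

⊕-comm : ∀ {m} (i : Fin m) j k → (i ⊕ j) ⊕ k ≡ (i ⊕ k) ⊕ j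
⊕-comm i j k = ≡.trans (⊕-⊕ i j k) (≡.trans (cong (i ⊕_) (+-comm j k)) (≡.sym (⊕-⊕ i k j)))

module _ {m k : ℕ} (1≤m : 1 ≤ m) (p : 1 ≤ k) (q : 2 * k ≤ m) where

  turn : ℕ → GPVertex m → GPVertex m
  turn j (u i) = u (i ⊕ j)
  turn j (v i) = v (i ⊕ j)

  turn-edge : ∀ j {x y} → GPEdge m k x y → GPEdge m k (turn j x) (turn j y)
  turn-edge j (outer i) = subst (λ l → GPEdge m k (u (i ⊕ j)) (u l)) (⊕-comm i j 1) (outer (i ⊕ j))
  turn-edge j (spoke i) = spoke (i ⊕ j)
  turn-edge j (inner i) = subst (λ l → GPEdge m k (v (i ⊕ j)) (v l)) (⊕-comm i j k) (inner (i ⊕ j))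

  turn-~ : ∀ j {x y} → SymClosure (GPEdge m k) x y → SymClosure (GPEdge m k) (turn j x) (turn j y)
  turn-~ j (fwd e) = fwd (turn-edge j e)
  turn-~ j (bwd e) = bwd (turn-edge j e)

  turn-back : ∀ x → turn 1 (turn (m ∸ 1) x) ≡ x
  turn-back (u i) = cong u (⊕-∸ i 1≤m)
  turn-back (v i) = cong v (⊕-∸ i 1≤m)

  back-turn : ∀ x → turn (m ∸ 1) (turn 1 x) ≡ x
  back-turn (u i) = cong u (≡.trans (⊕-comm i 1 (m ∸ 1)) (⊕-∸ i 1≤m))
  back-turn (v i) = cong v (≡.trans (⊕-comm i 1 (m ∸ 1)) (⊕-∸ i 1≤m))

  turning : GP m k p q ≅ GP m k p q
  turning = record
    { bijection = record
      { to        = turn 1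
      ; from      = turn (m ∸ 1)
      ; to-cong   = cong (turn 1)
      ; from-cong = cong (turn (m ∸ 1))
      ; inverse   = (λ { refl → turn-back _ }) , (λ { refl → back-turn _ })
      }
    ; ~-iff = λ x y → mk⇔ (turn-~ 1) λ e →
        ≡.subst₂ (SymClosure (GPEdge m k)) (back-turn x) (back-turn y) (turn-~ (m ∸ 1) e)
    }

module NotPetersen (n′ : ℕ) (4≤n : 4 ≤ suc n′) (3∣n : 3 ∣ suc n′)
  (m′ k : ℕ) (1≤k : 1 ≤ k) (2k≤m : 2 * k ≤ suc m′) (φ : X (suc n′) ≅ GP (suc m′) k 1≤k 2k≤m) where

  private m = suc m′
  open CayleyGraph n′
  open Girth8 n′ 4≤n using (edgeCount₈)
  open GeneralizedPetersen n′ using (perm; perm-period; reflection-even; exponent-even; multiple≡0)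
  private
    module φ = _≅_ φ
    module S₃×D = Group (S₃×D n)

  -- Comparing the numbers of vertices gives 12n ≤ 2m.
  m≰2n : ¬ m ≤ 2 * n
  m≰2n m≤2n = contradiction
    (≤-trans (injection⇒≤ {Graph.vertices (X n)} {≡.setoid (GPVertex m)} hasOrder (GPVertex↔Fin m)
        φ.to (λ {x} {y} → CycleMap.to-injective φ {x} {y}))
      (ℕ.+-mono-≤ m≤2n m≤2n))
    (<⇒≱ (subst (2 * n + 2 * n <_) (≡.sym (arith n′)) (m<m+n (2 * n + 2 * n) (s≤s z≤n))))
    where
    arith : ∀ n′ → 12 * suc n′ ≡ (2 * suc n′ + 2 * suc n′) + suc (7 + 8 * n′)
    arith = solve-∀

  rim : ℕ → V
  rim i = φ.from (u (zero ⊕ i))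

  rim-return : ∀ {i j} → rim (j + i) ≈ rim i → m ∣ j
  rim-return {i} {j} p = ⊕-fixed⇒∣ (zero ⊕ i) j
    (≡.trans (⊕-⊕ zero i j) (≡.trans (cong (zero ⊕_) (+-comm i j)) (u-injective
      (≡.trans (≡.sym (φ.strictlyInverseˡ _)) (≡.trans (φ.to-cong {rim (j + i)} {rim i} p) (φ.strictlyInverseˡ _))))))

  rim-step : ∀ i → rim i ~ rim (suc i)
  rim-step i = Equivalence.to (_≅_.~-iff (≅-sym φ) (u (zero ⊕ i)) (u (zero ⊕ suc i)))
    (fwd (subst (λ j → GPEdge m k (u (zero ⊕ i)) (u j)) (⊕-suc zero i) (outer (zero ⊕ i))))

  rim-onward : ∀ i → ¬ rim (2 + i) ≈ rim i
  rim-onward i p = m≰2n (≤-trans (∣⇒≤ (rim-return {i} {2} p)) (ℕ.*-monoʳ-≤ 2 {1} (s≤s z≤n)))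

  open Track rim rim-step rim-onward

  -- The rotation of the generalized Petersen graph by one step, transported to `X n`; it moves the
  -- pulled-back rim one place along itself.
  ψ : X n ≅ X n
  ψ = ≅-trans φ (≅-trans (turning (s≤s z≤n) 1≤k 2k≤m) (≅-sym φ))

  ψ-rim : ∀ i → _≅_.to ψ (rim i) ≈ rim (suc i)
  ψ-rim i = φ.from-cong (≡.trans (cong (turn (s≤s z≤n) 1≤k 2k≤m 1) (φ.strictlyInverseˡ (u (zero ⊕ i))))
    (cong u (⊕-suc zero i)))

  -- An edge of colour a lies on six 8-cycles, any other edge on five.
  letter-a : ∀ i → letter i ≡ 0F → letter (suc i) ≡ 0F
  letter-a i eq = go (letter (suc i)) refl
    where
    bound : ∀ {j l} → HasCardinality (cyclesThrough (X n) 8 (rim i) (rim i · letter i)) j →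
      HasCardinality (cyclesThrough (X n) 8 (rim (suc i)) (rim (suc i) · letter (suc i))) l → j ≤ l
    bound = cyclesThrough-≤ ψ {x = rim i} {rim i · letter i} {rim (suc i)} {rim (suc i) · letter (suc i)} (ψ-rim i)
      (S₃×D.trans {_≅_.to ψ (rim i · letter i)} {_≅_.to ψ (rim (suc i))} {rim (suc i) · letter (suc i)}
        (_≅_.to-cong ψ {rim i · letter i} {rim (suc i)} (S₃×D.sym {rim (suc i)} {rim i · letter i} (p-suc i)))
        (S₃×D.trans {_≅_.to ψ (rim (suc i))} {rim (2 + i)} {rim (suc i) · letter (suc i)} (ψ-rim (suc i)) (p-suc (suc i))))

    count : ∀ x s t → s ≡ t → HasCardinality (cyclesThrough (X n) 8 x (x · s)) (length (trivialWords 0 7 t))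
    count x s t refl = edgeCount₈ x s .proj₂ .proj₂

    go : ∀ t → letter (suc i) ≡ t → letter (suc i) ≡ 0F
    go 0F eq′ = eq′
    go 1F eq′ = contradiction (bound (count (rim i) (letter i) 0F eq) (count (rim (suc i)) (letter (suc i)) 1F eq′)) 1+n≰n
    go 2F eq′ = contradiction (bound (count (rim i) (letter i) 0F eq) (count (rim (suc i)) (letter (suc i)) 2F eq′)) 1+n≰n

  -- An a-edge on the rim would be followed by another a-edge, but consecutive letters differ.
  letter≢a : ∀ i → letter i ≢ 0F
  letter≢a i eq = letter-changes i (≡.trans eq (≡.sym (letter-a i eq)))

  alternates : ∀ {i j k : Letter} → i ≢ 0F → j ≢ 0F → k ≢ 0F → i ≢ j → j ≢ k → i ≡ k
  alternates {0F} p _ _ _ _ = contradiction refl p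
  alternates {1F} {0F} _ p _ _ _ = contradiction refl p
  alternates {1F} {1F} _ _ _ p _ = contradiction refl p
  alternates {1F} {2F} {0F} _ _ p _ _ = contradiction refl p
  alternates {1F} {2F} {1F} _ _ _ _ _ = refl
  alternates {1F} {2F} {2F} _ _ _ _ p = contradiction refl p
  alternates {2F} {0F} _ p _ _ _ = contradiction refl p
  alternates {2F} {2F} _ _ _ p _ = contradiction refl p
  alternates {2F} {1F} {0F} _ _ p _ _ = contradiction refl p
  alternates {2F} {1F} {2F} _ _ _ _ _ = refl
  alternates {2F} {1F} {1F} _ _ _ _ p = contradiction refl p

  letter-period : ∀ i → letter i ≡ letter (2 + i)
  letter-period i = alternates (letter≢a i) (letter≢a (1 + i)) (letter≢a (2 + i)) (letter-changes i) (letter-changes (1 + i))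

  -- `path` starts with b, so the comparison with the rim has to begin where the rim uses b;
  -- position 0 or 1 does.
  letter-b : ∃ λ i → letter i ≡ 1F
  letter-b = go (letter 0) refl (letter 1) refl
    where
    go : ∀ s → letter 0 ≡ s → ∀ t → letter 1 ≡ t → ∃ λ i → letter i ≡ 1F
    go 0F p _  _ = contradiction p (letter≢a 0)
    go 1F p _  _ = 0 , p
    go 2F _ 0F q = contradiction q (letter≢a 1)
    go 2F _ 1F q = 1 , q
    go 2F p 2F q = contradiction (≡.trans p (≡.sym q)) (letter-changes 0)

  letter-alternate : ∀ i → letter i ≡ 1F → ∀ j → letter (j + i) ≡ alternate 1F 2F j
  letter-alternate i p 0             = p
  letter-alternate i p 1             = go (letter (suc i)) refl
    where
    go : ∀ t → letter (suc i) ≡ t → letter (suc i) ≡ 2F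
    go 0F q = contradiction q (letter≢a (suc i))
    go 1F q = contradiction (≡.trans p (≡.sym q)) (letter-changes i)
    go 2F q = q
  letter-alternate i p (suc (suc j)) = ≡.trans (≡.sym (letter-period (j + i))) (letter-alternate i p j)

  rim-path : ∀ i → letter i ≡ 1F → ∀ j → rim (j + i) ≈ (rim i S₃×D.∙ path j)
  rim-path i p zero    = S₃×D.sym {rim i S₃×D.∙ path 0} {rim i} (S₃×D.identityʳ (rim i))
  rim-path i p (suc j) = S₃×D.trans {rim (suc j + i)} {rim (j + i) · letter (j + i)} {rim i S₃×D.∙ path (suc j)}
    (p-suc (j + i))
    (extend (letter (j + i)) (letter-alternate i p j))
    where
    extend : ∀ s → s ≡ alternate 1F 2F j → rim (j + i) · s ≈ (rim i S₃×D.∙ path (suc j))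
    extend s refl = S₃×D.trans {rim (j + i) · s} {(rim i S₃×D.∙ path j) · s} {rim i S₃×D.∙ path (suc j)}
      (·-cong {rim (j + i)} {rim i S₃×D.∙ path j} s (rim-path i p j))
      (S₃×D.trans {(rim i S₃×D.∙ path j) · s} {rim i S₃×D.∙ (path j · s)} {rim i S₃×D.∙ path (suc j)}
        (S₃×D.assoc (rim i) (path j) (colour s))
        (S₃×D.∙-congˡ {rim i} {path j · s} {path (suc j)} (path-suc j)))

  -- For 3 ∣ n the element bc has order n only: its permutation part already vanishes at the nth
  -- power.
  path-closes : path (n * 2) ≈ path 0
  path-closes = close 3∣n
    where
    close : 3 ∣ n → path (n * 2) ≈ path 0
    close (ℕ∣.divides q eq) = byCoordinates (path (n * 2)) (path 0)
      (λ j → ≡.trans (cong (λ i → perm i j) (≡.trans (cong (_* 2) eq) (arith q))) (perm-period q 0 j))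
      (reflection-even n)
      (subst (_≡ ℤ.+ 0 [mod n ]) (≡.sym (exponent-even n)) (multiple≡0 1 (≡.sym (ℕ.*-identityˡ n))))
      where
      arith : ∀ q → q * 3 * 2 ≡ q * 6 + 0
      arith = solve-∀

  impossible : ∀ {A : Set} → A
  impossible = contradiction (subst (m ≤_) (ℕ.*-comm n 2) (∣⇒≤ (rim-return {i} {n * 2}
    (S₃×D.trans {rim (n * 2 + i)} {rim i S₃×D.∙ path (n * 2)} {rim i} (rim-path i p (n * 2))
      (S₃×D.trans {rim i S₃×D.∙ path (n * 2)} {rim i S₃×D.∙ path 0} {rim i}
        (S₃×D.∙-congˡ {rim i} {path (n * 2)} {path 0} path-closes) (S₃×D.identityʳ (rim i))))))) m≰2n
    where
    i = letter-b .proj₁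
    p = letter-b .proj₂

-- The residue classes of n modulo 3

X≅GP-n%3≡1 : ∀ n → n % 3 ≡ 1 → ∃₂ λ p q → X n ≅ GP (6 * n) (2 * n ∸ 1) p q
X≅GP-n%3≡1 n n%3≡1 = go n 3∤n (n / 3) (≡.trans (m≡m%n+[m/n]*n n 3) (cong (_+ n / 3 * 3) n%3≡1))
  where
  3∤n : ¬ 3 ∣ n
  3∤n 3∣n = contradiction (≡.trans (≡.sym n%3≡1) (ℕ∣.n∣m⇒m%n≡0 n 3 3∣n)) λ ()

  go : ∀ n → ¬ 3 ∣ n → ∀ q → n ≡ 1 + q * 3 → ∃₂ λ p q → X n ≅ GP (6 * n) (2 * n ∸ 1) p q
  go _ 3∤n q refl = X≅GP-1mod3 q 3∤n

X≅GP-n%3≡2 : ∀ n → n % 3 ≡ 2 → ∃₂ λ p q → X n ≅ GP (6 * n) (2 * n + 1) p q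
X≅GP-n%3≡2 n n%3≡2 = go n 3∤n (n / 3) (≡.trans (m≡m%n+[m/n]*n n 3) (cong (_+ n / 3 * 3) n%3≡2))
  where
  3∤n : ¬ 3 ∣ n
  3∤n 3∣n = contradiction (≡.trans (≡.sym n%3≡2) (ℕ∣.n∣m⇒m%n≡0 n 3 3∣n)) λ ()

  go : ∀ n → ¬ 3 ∣ n → ∀ q → n ≡ 2 + q * 3 → ∃₂ λ p q → X n ≅ GP (6 * n) (2 * n + 1) p q
  go _ 3∤n q refl = X≅GP-2mod3 q 3∤n

X≇GP : ∀ n → 4 ≤ n → n % 3 ≡ 0 → ∀ m k p q → ¬ (X n ≅ GP m k p q)
X≇GP (suc n′) 4≤n n%3≡0 zero     k p q φ = contradiction (≤-trans (ℕ.*-monoʳ-≤ 2 p) q) λ ()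
X≇GP (suc n′) 4≤n n%3≡0 (suc m′) k p q φ =
  NotPetersen.impossible n′ 4≤n (ℕ∣.m%n≡0⇒n∣m (suc n′) 3 n%3≡0) m′ k p q φ

structure : ∀ n → 3 ≤ n →
  Connected (X n) × VertexTransitive (X n) × Is3RDR (X n) × HasOrder (X n) (12 * n)
structure (suc n′) _ = connected , vertexTransitive , RainbowDomination.is3RDR n′ , hasOrder
  where open CayleyGraph n′

girth-signature : ∀ n → 4 ≤ n → HasGirth (X n) 8 × HasSignature (X n) (5 , 5 , 6)
girth-signature (suc n′) 4≤n = Girth8.girth₈ n′ 4≤n , Girth8.signature₈ n′ 4≤n

theorem4p7 : (∀ n → 3 ≤ n →
    Connected (X n) × VertexTransitive (X n) × Is3RDR (X n) × HasOrder (X n) (12 * n))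
    × (HasGirth (X 3) 6 × HasSignature (X 3) (0 , 1 , 1))
    × (∀ n → 4 ≤ n →
    HasGirth (X n) 8
    × HasSignature (X n) (5 , 5 , 6)
    × (n % 3 ≡ 1 → ∃₂ λ p q → X n ≅ GP (6 * n) (2 * n ∸ 1) p q)
    × (n % 3 ≡ 2 → ∃₂ λ p q → X n ≅ GP (6 * n) (2 * n + 1) p q)
    × (n % 3 ≡ 0 → ∀ m k p q → ¬ (X n ≅ GP m k p q)))
theorem4p7 = structure , (girth₃ , signature₃) , λ n 4≤n →
  girth-signature n 4≤n .proj₁ , girth-signature n 4≤n .proj₂ ,
  X≅GP-n%3≡1 n , X≅GP-n%3≡2 n , X≇GP n 4≤n
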